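{- Let $m$ be a positive integer and let $G$ be a $2m$-edge-connected graph with a factor $M$ satisfying $\Delta(M)\le m$. Then $G$ can be decomposed into (i.e., its edge set partitioned into the edge sets of) an $m$-tree-connected factor $H$ containing $M$ and a factor $F$ having an orientation such that for each vertex $v$, $d^+_F(v)\ge \lfloor \frac{d_G(v)}{2}\rfloor-m$. Furthermore, for an arbitrary given vertex $u$, this can be done so that in addition $d^+_F(u)\ge\lceil \frac{d_G(u)}{2}\rceil$.
   Context: Graphs are finite, loopless, and may have multiple edges. A factor is a spanning subgraph; a graph is $m$-tree-connected if it contains $m$ pairwise edge-disjoint spanning trees. $d^+_F(v)$ is the out-degree of $v$ in the oriented $F$. -}

module Defs where

open import Data.Nat using (ℕ; zero; suc; _+_; _*_; _∸_; _≤_; _<_; ⌊_/2⌋; ⌈_/2⌉)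
open import Data.Fin using (Fin; zero; suc)
open import Data.Bool using (Bool; true; false; not; _∧_; if_then_else_)
open import Data.Product using (Σ; _×_; _,_; proj₁; proj₂; ∃)
open import Data.Sum using (_⊎_)
open import Relation.Binary.PropositionalEquality using (_≡_; _≢_)
open import Relation.Nullary using (¬_)
open import Function.Definitions using (Injective)

-- A finite loopless multigraph: vertices Fin n, edges Fin k, each edge with two
-- (ordered, for bookkeeping only) distinct endpoints. Parallel edges allowed.
record Graph : Set where
  field
    n        : ℕ
    k        : ℕ
    ends     : Fin k → Fin n × Fin n
    loopless : ∀ e → proj₁ (ends e) ≢ proj₂ (ends e)
open Graph public

-- Edge subsets (spanning subgraphs / factors) are Boolean predicates on edges.
EdgeSet : Graph → Set
EdgeSet G = Fin (k G) → Bool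

count : ∀ {r} → (Fin r → Bool) → ℕ
count {zero}  P = 0
count {suc r} P = (if P zero then 1 else 0) + count (λ i → P (suc i))

Sub : (G : Graph) → EdgeSet G → EdgeSet G → Set
Sub G A B = ∀ (e : Fin (k G)) → A e ≡ true → B e ≡ true

Joins : (G : Graph) → Fin (k G) → Fin (n G) → Fin (n G) → Set
Joins G e a b = ends G e ≡ (a , b) ⊎ ends G e ≡ (b , a)

deg : (G : Graph) → EdgeSet G → Fin (n G) → ℕ
deg G A v = count (λ e → A e ∧ incident e)
  where
  open import Data.Fin using (_≟_)
  open import Relation.Nullary.Decidable using (⌊_⌋)
  open import Data.Bool using (_∨_)
  incident : Fin (k G) → Bool
  incident e = ⌊ proj₁ (ends G e) ≟ v ⌋ ∨ ⌊ proj₂ (ends G e) ≟ v ⌋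

allEdges : (G : Graph) → EdgeSet G
allEdges G _ = true

degG : (G : Graph) → Fin (n G) → ℕ
degG G = deg G (allEdges G)

MaxDegLe : (G : Graph) → EdgeSet G → ℕ → Set
MaxDegLe G A d = ∀ v → deg G A v ≤ d

data Reach (G : Graph) (A : EdgeSet G) : Fin (n G) → Fin (n G) → Set where
  here : ∀ {u} → Reach G A u u
  step : ∀ {u w v} (e : Fin (k G)) → A e ≡ true → Joins G e u w →
         Reach G A w v → Reach G A u v

Connected : (G : Graph) → EdgeSet G → Set
Connected G A = ∀ u v → Reach G A u v

EdgeConnected : ℕ → Graph → Set
EdgeConnected l G = ∀ (X : EdgeSet G) → count X < l →
  Connected G (λ e → not (X e))

-- cyclic successor on Fin (suc r)
next : ∀ {r} → Fin (suc r) → Fin (suc r)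
next {zero}  zero    = zero
next {suc r} zero    = suc zero
next {suc r} (suc i) with next {r} i
... | zero  = zero
... | suc j = suc (suc j)

-- a cycle in A: j ≥ 2 distinct vertices v_0..v_{j-1} and distinct edges
-- e_0..e_{j-1} of A with e_i joining v_i and v_{i+1 mod j}
-- (length 2 = a pair of parallel edges, since graphs are loopless)
record Cycle (G : Graph) (A : EdgeSet G) : Set where
  field
    len   : ℕ
    vs    : Fin (suc (suc len)) → Fin (n G)
    es    : Fin (suc (suc len)) → Fin (k G)
    vsInj : Injective _≡_ _≡_ vs
    esInj : Injective _≡_ _≡_ es
    inA   : ∀ i → A (es i) ≡ true
    joins : ∀ i → Joins G (es i) (vs i) (vs (next i))

SpanningTree : (G : Graph) → EdgeSet G → Set
SpanningTree G T = Connected G T × ¬ Cycle G T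

TreeConnected : (G : Graph) → ℕ → EdgeSet G → Set
TreeConnected G m H = Σ (Fin m → EdgeSet G) λ T →
  (∀ i → Sub G (T i) H) × (∀ i → SpanningTree G (T i)) ×
  (∀ i j e → i ≢ j → T i e ≡ true → T j e ≡ false)

-- orientation of edge e: true = from proj₁ (ends e) to proj₂ (ends e), false = reverse
Orientation : Graph → Set
Orientation G = Fin (k G) → Bool

tail : (G : Graph) → Orientation G → Fin (k G) → Fin (n G)
tail G o e = if o e then proj₁ (ends G e) else proj₂ (ends G e)

outdeg : (G : Graph) → EdgeSet G → Orientation G → Fin (n G) → ℕ
outdeg G F o v = count (λ e → F e ∧ ⌊ tail G o e ≟ v ⌋)
  where
  open import Data.Fin using (_≟_)
  open import Relation.Nullary.Decidable using (⌊_⌋)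

GoodDecomp : (G : Graph) → ℕ → EdgeSet G → EdgeSet G → Orientation G → Set
GoodDecomp G m M h o =
  TreeConnected G m h × Sub G M h ×
  (∀ v → ⌊ degG G v /2⌋ ∸ m ≤ outdeg G (λ e → not (h e)) o v)

{-# OPTIONS --safe #-}
module Submission where

-- Glue m copies of G at u, and attach p(v) pendant "slots" to the glued vertex for each v, where
-- p(u) = ⌈d(u)/2⌉ and p(v) = ⌊d(v)/2⌋ - m otherwise. An edge e of G is a color that can be realized
-- as its copy in one of the copies of G (e joins a tree) or, if e is not in M, as the edge to a slot
-- of one of its ends (e joins F, oriented away from that end). A connected rainbow subgraph is
-- exactly what is wanted.
--
-- By Rado's theorem for graphic matroids it exists as soon as, for every partition of the vertices
-- into q classes, at least q - 1 colors have an edge between two classes. With P the common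
-- refinement of the partitions of the m copies and S the set of the v having a slot outside the
-- class of u, this follows from: m(|P| - 1) + p(S) is at most the number of edges of G that cross P,
-- or are not in M and touch S. To see this, double count: twice the number of the edges that cross
-- P or touch S is d(S) plus the sum of d(X ∖ S) over the blocks X of P, where d(X ∖ S) ≥ 2m unless
-- X ⊆ S. The edges of M inside blocks that touch S are few: each of them has an end in S that is
-- not the representative of a block contained in S, and Δ(M) ≤ m.

open import Defs
open import Data.Bool as Bool using (Bool; true; false; not; _∧_; _∨_; _xor_; if_then_else_)
open import Data.Bool.Properties using (¬-not; ∧-zeroʳ; ∧-identityʳ; ∨-identityʳ; if-eta)
open import Data.Empty using (⊥; ⊥-elim)
open import Data.Fin using (Fin; zero; suc; _≟_; toℕ; inject≤; _↑ˡ_; _↑ʳ_; combine; remQuot; splitAt)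
open import Data.Fin.Properties using (any?; all?; suc-injective; toℕ<n; toℕ-inject≤; inject≤-injective;
  ↑ʳ-injective; splitAt-↑ˡ; splitAt-↑ʳ; splitAt⁻¹-↑ˡ; splitAt⁻¹-↑ʳ;
  remQuot-combine; combine-remQuot; combine-injective; combine-injectiveʳ)
open import Data.Maybe as Maybe using (Maybe; just; nothing; is-just)
open import Data.Maybe.Properties using (just-injective)
open import Data.Nat using (ℕ; zero; suc; _+_; _*_; _∸_; _≤_; _<_; _≤?_; _<?_; z≤n; s≤s; ⌊_/2⌋; ⌈_/2⌉)
open import Data.Nat.Properties as ℕ hiding (_≟_; _≤?_; _<?_; suc-injective)
open import Data.Nat.Tactic.RingSolver using (solve-∀)
open import Data.Product using (Σ; ∃; _×_; _,_; proj₁; proj₂)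
open import Data.Sum using (_⊎_; inj₁; inj₂)
open import Data.Vec.Functional using (updateAt)
open import Data.Vec.Functional.Properties using (updateAt-updates; updateAt-minimal)
open import Function using (_∘_; id; const; case_of_)
open import Relation.Binary.PropositionalEquality
open import Relation.Nullary using (¬_; Dec; yes; no; ¬?; _×-dec_; _⊎-dec_)
open import Relation.Nullary.Decidable using (⌊_⌋; map′; decidable-stable)
open import Relation.Unary using (Decidable)
open import Algebra.Properties.Semiring.Sum +-*-semiring
  using (sum; ∑-comm; ∑-distrib-+; sum-cong-≗; *-distribˡ-sum)

private
  variable
    A : Set
    a b : ℕ

-- Decisions as Booleans

⌊⌋⁺ : (a? : Dec A) → A → ⌊ a? ⌋ ≡ true
⌊⌋⁺ (yes _) _ = refl
⌊⌋⁺ (no ¬x) x = ⊥-elim (¬x x)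

⌊⌋⁻ : (a? : Dec A) → ⌊ a? ⌋ ≡ true → A
⌊⌋⁻ (yes x) _ = x

⌊⌋⁻ᶠ : (a? : Dec A) → ⌊ a? ⌋ ≡ false → ¬ A
⌊⌋⁻ᶠ (no ¬x) _ = ¬x

⌊⌋⁺ᶠ : (a? : Dec A) → ¬ A → ⌊ a? ⌋ ≡ false
⌊⌋⁺ᶠ (yes x) ¬x = ⊥-elim (¬x x)
⌊⌋⁺ᶠ (no _)  _  = refl

true≢false : ∀ {x} → x ≡ true → x ≡ false → ⊥
true≢false refl ()

-- Counting

infix 4 _⊆_
_⊆_ : (Fin a → Bool) → (Fin a → Bool) → Set
P ⊆ Q = ∀ i → P i ≡ true → Q i ≡ true

count-mono : {P Q : Fin a → Bool} → P ⊆ Q → count P ≤ count Q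
count-mono {zero}              P⊆Q = z≤n
count-mono {suc a} {P = P} {Q} P⊆Q with P zero in p | Q zero in q
... | false | false = count-mono (P⊆Q ∘ suc)
... | false | true  = m≤n⇒m≤1+n (count-mono (P⊆Q ∘ suc))
... | true  | true  = s≤s (count-mono (P⊆Q ∘ suc))
... | true  | false = ⊥-elim (true≢false (P⊆Q zero p) q)

count-cong : {P Q : Fin a → Bool} → P ≗ Q → count P ≡ count Q
count-cong P≗Q = ≤-antisym (count-mono (λ i p → trans (sym (P≗Q i)) p))
                           (count-mono (λ i q → trans (P≗Q i) q))

count-none : {P : Fin a → Bool} → (∀ i → P i ≡ false) → count P ≡ 0
count-none {zero}  P∅ = refl
count-none {suc a} P∅ rewrite P∅ zero = count-none (P∅ ∘ suc)

count≤ : (P : Fin a → Bool) → count P ≤ a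
count≤ {zero}  P = z≤n
count≤ {suc a} P with P zero
... | true  = s≤s (count≤ (P ∘ suc))
... | false = m≤n⇒m≤1+n (count≤ (P ∘ suc))

count-insert : {P Q : Fin a → Bool} (x : Fin a) → P x ≡ false → Q x ≡ true →
  (∀ y → y ≢ x → P y ≡ Q y) → count Q ≡ suc (count P)
count-insert {P = P} {Q} zero px qx same rewrite px | qx =
  cong suc (sym (count-cong (λ i → same (suc i) λ ())))
count-insert {P = P} {Q} (suc x) px qx same
  rewrite same zero (λ ()) with Q zero
... | true  = cong suc (count-insert x px qx λ y y≢x → same (suc y) (y≢x ∘ suc-injective))
... | false = count-insert x px qx λ y y≢x → same (suc y) (y≢x ∘ suc-injective)

infixl 7 _∖_
_∖_ : (Fin a → Bool) → Fin a → (Fin a → Bool)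
(P ∖ x) y = P y ∧ not ⌊ y ≟ x ⌋

∖-∉ : (P : Fin a → Bool) (x : Fin a) → (P ∖ x) x ≡ false
∖-∉ P x with x ≟ x
... | yes _ = ∧-zeroʳ (P x)
... | no x≢x = ⊥-elim (x≢x refl)

∖-≢ : (P : Fin a → Bool) (x y : Fin a) → y ≢ x → (P ∖ x) y ≡ P y
∖-≢ P x y y≢x with y ≟ x
... | yes y≡x = ⊥-elim (y≢x y≡x)
... | no _    = ∧-identityʳ (P y)

∖-⁻ : (P : Fin a → Bool) (x y : Fin a) → (P ∖ x) y ≡ true → P y ≡ true × y ≢ x
∖-⁻ P x y p with P y | y ≟ x
... | true | no y≢x = refl , y≢x

∖-⁺ : (P : Fin a → Bool) (x y : Fin a) → P y ≡ true → y ≢ x → (P ∖ x) y ≡ true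
∖-⁺ P x y p y≢x = trans (∖-≢ P x y y≢x) p

count-∖ : (P : Fin a → Bool) (x : Fin a) → P x ≡ true → count P ≡ suc (count (P ∖ x))
count-∖ P x px = count-insert x (∖-∉ P x) px (∖-≢ P x)

count-injective : {P : Fin a → Bool} {Q : Fin b → Bool} (φ : Fin a → Fin b) →
  (∀ i → P i ≡ true → Q (φ i) ≡ true) →
  (∀ i j → P i ≡ true → P j ≡ true → φ i ≡ φ j → i ≡ j) → count P ≤ count Q
count-injective {zero} φ maps inj = z≤n
count-injective {suc a} {P = P} {Q} φ maps inj with P zero in p
... | false = count-injective (φ ∘ suc) (maps ∘ suc) λ i j pi pj e → suc-injective (inj (suc i) (suc j) pi pj e)
... | true  = ≤-trans
  (s≤s (count-injective {Q = Q ∖ φ zero} (φ ∘ suc)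
    (λ i pi → ∖-⁺ Q (φ zero) (φ (suc i)) (maps (suc i) pi)
      λ e → case (inj (suc i) zero pi p e) of λ ())
    λ i j pi pj e → suc-injective (inj (suc i) (suc j) pi pj e)))
  (≤-reflexive (sym (count-∖ Q (φ zero) (maps zero p))))

count-disjoint : {P Q R : Fin a → Bool} → (∀ i → P i ≡ true → Q i ≡ false) →
  P ⊆ R → Q ⊆ R → count P + count Q ≤ count R
count-disjoint {zero} dis P⊆R Q⊆R = z≤n
count-disjoint {suc a} {P = P} {Q} {R} dis P⊆R Q⊆R
  with IH ← count-disjoint (dis ∘ suc) (P⊆R ∘ suc) (Q⊆R ∘ suc)
  with P zero in p | Q zero in q | R zero in r
... | true  | true  | _     = ⊥-elim (true≢false q (dis zero p))
... | true  | false | false = ⊥-elim (true≢false (P⊆R zero p) r)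
... | false | true  | false = ⊥-elim (true≢false (Q⊆R zero q) r)
... | true  | false | true  = s≤s IH
... | false | true  | true  = ≤-trans (≤-reflexive (+-suc _ _)) (s≤s IH)
... | false | false | true  = m≤n⇒m≤1+n IH
... | false | false | false = IH

count≤1⇒unique : (P : Fin a → Bool) → count P ≤ 1 →
  ∀ x y → P x ≡ true → P y ≡ true → x ≡ y
count≤1⇒unique P P≤1 x y px py with x ≟ y
... | yes x≡y = x≡y
... | no  x≢y with subst (_≤ 1) (trans (count-∖ P x px)
                     (cong suc (count-∖ (P ∖ x) y (∖-⁺ P x y py (x≢y ∘ sym))))) P≤1
...   | s≤s ()

-- Partitions of a finite set, given by idempotent labelings

Idem : (Fin a → Fin a) → Set
Idem f = ∀ x → f (f x) ≡ f x

infix 4 _⊑_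
-- The refinement order on partitions, with the finer one on the left.
_⊑_ : (Fin a → A) → (Fin a → A) → Set
f ⊑ g = ∀ {x y} → f x ≡ f y → g x ≡ g y

fixed : (Fin a → Fin a) → Fin a → Bool
fixed f x = ⌊ f x ≟ x ⌋

-- Each class of an idempotent labeling contains exactly one fixed point, its label, so this is the
-- number of classes.
fixes : (Fin a → Fin a) → ℕ
fixes f = count (fixed f)

-- `f` maps fixed points of `g` to fixed points of `f`, injectively because two fixed points of `g`
-- with the same `f`-label also have the same `g`-label.
fixes-antitone : {f g : Fin a → Fin a} → Idem f → f ⊑ g → fixes g ≤ fixes f
fixes-antitone {f = f} {g} idem f⊑g = count-injective f
  (λ x _ → ⌊⌋⁺ (f (f x) ≟ f x) (idem x))
  λ x y gx gy fx≡fy → trans (sym (⌊⌋⁻ (g x ≟ x) gx)) (trans (f⊑g fx≡fy) (⌊⌋⁻ (g y ≟ y) gy))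

merge : Fin a → Fin a → (Fin a → Fin a) → Fin a → Fin a
merge x y f z = if ⌊ f z ≟ f x ⌋ then f y else f z

module _ (x y : Fin a) (f : Fin a → Fin a) where

  merge-idem : Idem f → Idem (merge x y f)
  merge-idem idem z with f z ≟ f x
  ... | yes _ with f (f y) ≟ f x
  ...   | yes _ = refl
  ...   | no  _ = idem y
  merge-idem idem z | no fz≢fx with f (f z) ≟ f x
  ...   | yes ffz≡fx = ⊥-elim (fz≢fx (trans (sym (idem z)) ffz≡fx))
  ...   | no  _ = idem z

  merge-⊒ : f ⊑ merge x y f
  merge-⊒ {z} {w} fz≡fw rewrite fz≡fw = refl

  merge-joins : merge x y f x ≡ merge x y f y
  merge-joins with f x ≟ f x | f y ≟ f x
  ... | yes _ | yes _ = refl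
  ... | yes _ | no _  = refl
  ... | no ne | _     = ⊥-elim (ne refl)

  -- Minimality is stated for a general relation `E`, so that it later applies to reachability as
  -- well as to labelings.
  merge-least : (E : Fin a → Fin a → Set) → (∀ {z w} → E z w → E w z) →
    (∀ {z w v} → E z w → E w v → E z v) → E x y →
    (∀ {z w} → f z ≡ f w → E z w) →
    ∀ {z w} → merge x y f z ≡ merge x y f w → E z w
  merge-least E E-sym E-trans Exy f⇒E {z} {w} eq with f z ≟ f x | f w ≟ f x
  ... | yes p | yes q = f⇒E (trans p (sym q))
  ... | yes p | no  _ = E-trans (f⇒E p) (E-trans Exy (f⇒E eq))
  ... | no  _ | yes q = E-trans (f⇒E eq) (E-trans (E-sym Exy) (f⇒E (sym q)))
  ... | no  _ | no  _ = f⇒E eq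

  merge-⊑ : {g : Fin a → Fin a} → f ⊑ g → g x ≡ g y → merge x y f ⊑ g
  merge-⊑ {g} f⊑g gx≡gy = merge-least (λ z w → g z ≡ g w) sym trans gx≡gy f⊑g

  -- The matroid exchange step: if merging `x` and `y` is what joins `z` and `w`, then one of `z`,
  -- `w` lies in the class of `x` and the other in that of `y`. Hence joining `z` and `w` in a
  -- coarser `g` joins `x` and `y`.
  merge-exchange : {g : Fin a → Fin a} {z w : Fin a} → f z ≢ f w →
    merge x y f z ≡ merge x y f w → f ⊑ g → g z ≡ g w → g x ≡ g y
  merge-exchange {g} {z} {w} fz≢fw eq f⊑g gz≡gw with f z ≟ f x | f w ≟ f x
  ... | yes p | yes q = ⊥-elim (fz≢fw (trans p (sym q)))
  ... | yes p | no  _ = trans (f⊑g (sym p)) (trans gz≡gw (sym (f⊑g eq)))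
  ... | no  _ | yes q = trans (f⊑g (sym q)) (trans (sym gz≡gw) (f⊑g eq))
  ... | no  _ | no  _ = ⊥-elim (fz≢fw eq)

  fixes-merge-≤ : Idem f → fixes f ≤ suc (fixes (merge x y f))
  fixes-merge-≤ idem = ≤-trans
    (≤-reflexive (count-∖ (fixed f) (f x) (⌊⌋⁺ (f (f x) ≟ f x) (idem x))))
    (s≤s (count-mono λ z fz → let fz≡z , z≢fx = ∖-⁻ (fixed f) (f x) z fz in
      ⌊⌋⁺ (merge x y f z ≟ z) (lemma z (⌊⌋⁻ (f z ≟ z) fz≡z) z≢fx)))
    where
    lemma : ∀ z → f z ≡ z → z ≢ f x → merge x y f z ≡ z
    lemma z fz≡z z≢fx with f z ≟ f x
    ... | yes fz≡fx = ⊥-elim (z≢fx (trans (sym fz≡z) fz≡fx))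
    ... | no  _     = fz≡z

  fixes-merge-< : Idem f → f x ≢ f y → fixes (merge x y f) < fixes f
  fixes-merge-< idem fx≢fy = ≤-trans
    (s≤s (count-mono λ z mz → let fz≡z , z≢fx = lemma z (⌊⌋⁻ (merge x y f z ≟ z) mz) in
      ∖-⁺ (fixed f) (f x) z (⌊⌋⁺ (f z ≟ z) fz≡z) z≢fx))
    (≤-reflexive (sym (count-∖ (fixed f) (f x) (⌊⌋⁺ (f (f x) ≟ f x) (idem x)))))
    where
    lemma : ∀ z → merge x y f z ≡ z → f z ≡ z × z ≢ f x
    lemma z eq with f z ≟ f x
    ... | yes fz≡fx = ⊥-elim (fx≢fy (trans (sym fz≡fx) (trans (cong f (sym eq)) (idem y))))
    ... | no  fz≢fx = eq , λ z≡fx → fz≢fx (trans eq z≡fx)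

-- The partition obtained from ℓ₀ by contracting the edges listed in s.
lab : ∀ {N c} → (Fin N → Fin N) → (Fin c → Maybe (Fin N × Fin N)) → Fin N → Fin N
lab {c = zero}  ℓ₀ s = ℓ₀
lab {c = suc c} ℓ₀ s with s zero
... | nothing      = lab ℓ₀ (s ∘ suc)
... | just (x , y) = merge x y (lab ℓ₀ (s ∘ suc))

module _ {N : ℕ} {ℓ₀ : Fin N → Fin N} where

  lab-idem : ∀ {c} (s : Fin c → Maybe (Fin N × Fin N)) → Idem ℓ₀ → Idem (lab ℓ₀ s)
  lab-idem {zero}  s idem = idem
  lab-idem {suc c} s idem with s zero
  ... | nothing      = lab-idem (s ∘ suc) idem
  ... | just (x , y) = merge-idem x y (lab ℓ₀ (s ∘ suc)) (lab-idem (s ∘ suc) idem)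

  lab-⊒ : ∀ {c} (s : Fin c → Maybe (Fin N × Fin N)) → ℓ₀ ⊑ lab ℓ₀ s
  lab-⊒ {zero}  s eq = eq
  lab-⊒ {suc c} s eq with s zero
  ... | nothing      = lab-⊒ (s ∘ suc) eq
  ... | just (x , y) = merge-⊒ x y (lab ℓ₀ (s ∘ suc)) (lab-⊒ (s ∘ suc) eq)

  lab-joins : ∀ {c} (s : Fin c → Maybe (Fin N × Fin N)) e {x y} →
    s e ≡ just (x , y) → lab ℓ₀ s x ≡ lab ℓ₀ s y
  lab-joins {suc c} s zero    se with s zero
  lab-joins {suc c} s zero    refl | just (x , y) = merge-joins x y (lab ℓ₀ (s ∘ suc))
  lab-joins {suc c} s (suc e) se with s zero
  ... | nothing      = lab-joins (s ∘ suc) e se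
  ... | just (x , y) = merge-⊒ x y (lab ℓ₀ (s ∘ suc)) (lab-joins (s ∘ suc) e se)

  lab-least : ∀ {c} (s : Fin c → Maybe (Fin N × Fin N)) (E : Fin N → Fin N → Set) →
    (∀ {z w} → E z w → E w z) → (∀ {z w v} → E z w → E w v → E z v) →
    (∀ {z w} → ℓ₀ z ≡ ℓ₀ w → E z w) → (∀ e {x y} → s e ≡ just (x , y) → E x y) →
    ∀ {z w} → lab ℓ₀ s z ≡ lab ℓ₀ s w → E z w
  lab-least {zero}  s E E-sym E-trans base edge eq = base eq
  lab-least {suc c} s E E-sym E-trans base edge eq with s zero in s₀
  ... | nothing      = lab-least (s ∘ suc) E E-sym E-trans base (edge ∘ suc) eq
  ... | just (x , y) = merge-least x y (lab ℓ₀ (s ∘ suc)) E E-sym E-trans (edge zero s₀)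
                         (lab-least (s ∘ suc) E E-sym E-trans base (edge ∘ suc)) eq

  -- Each contracted edge costs at most one class, by `fixes-merge-≤`.
  lab-size : ∀ {c} (s : Fin c → Maybe (Fin N × Fin N)) → Idem ℓ₀ →
    fixes ℓ₀ ≤ fixes (lab ℓ₀ s) + count (is-just ∘ s)
  lab-size {zero}  s idem = m≤m+n _ 0
  lab-size {suc c} s idem with IH ← lab-size (s ∘ suc) idem | s zero
  ... | nothing      = IH
  ... | just (x , y) = ≤-trans IH (≤-trans
    (+-monoˡ-≤ _ (fixes-merge-≤ x y (lab ℓ₀ (s ∘ suc)) (lab-idem (s ∘ suc) idem))) (≤-reflexive (sym (+-suc _ _))))

-- Rado's theorem for graphic matroids: connected rainbow subgraphs

Joined : (Fin a → A) → Fin a × Fin a → Set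
Joined f (x , y) = f x ≡ f y

Joined-mono : (f g : Fin a → Fin b) → f ⊑ g → ∀ xy → Joined f xy → Joined g xy
Joined-mono f g f⊑g _ = f⊑g

joined? : (f : Fin a → Fin b) (xy : Fin a × Fin a) → Dec (Joined f xy)
joined? f (x , y) = f x ≟ f y

-- The color `e` owns the edges `real e q` for `q : C`. A `Choice` selects at most one edge of each
-- color, so that the selected subgraph is rainbow; connectivity is measured over the initial
-- partition `ℓ₀`.
module Rainbow {N c : ℕ} (ℓ₀ : Fin N → Fin N) (idem₀ : Idem ℓ₀)
  (C : Set) (anyC? : {P : C → Set} → Decidable P → Dec (∃ P))
  (real : Fin c → C → Fin N × Fin N) where

  Choice : Set
  Choice = Fin c → Maybe C

  Crosses : (Fin N → Fin N) → Fin c → Set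
  Crosses f e = ∃ λ q → ¬ Joined f (real e q)

  crosses? : ∀ f → Decidable (Crosses f)
  crosses? f e = anyC? λ q → ¬? (joined? f (real e q))

  inside : (Fin N → Fin N) → Fin c → Bool
  inside f e = not ⌊ crosses? f e ⌋

  inside⁻ : ∀ f e → inside f e ≡ true → ∀ q → Joined f (real e q)
  inside⁻ f e _  q with crosses? f e
  inside⁻ f e () q | yes _
  ... | no ¬cross with joined? f (real e q)
  ...   | yes j = j
  ...   | no ¬j = ⊥-elim (¬cross (q , ¬j))

  inside-false : ∀ f e → inside f e ≡ false → Crosses f e
  inside-false f e _ with crosses? f e
  ... | yes cross = cross

  inside-mono : ∀ f g → f ⊑ g → inside f ⊆ inside g
  inside-mono f g f⊑g e in-f with inside g e in in-g
  ... | true  = refl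
  ... | false with q , ¬j ← inside-false g e in-g =
    ⊥-elim (¬j (Joined-mono f g f⊑g (real e q) (inside⁻ f e in-f q)))

  selected : Choice → (Fin c → Bool) → Fin c → Maybe (Fin N × Fin N)
  selected s D e = if D e then Maybe.map (real e) (s e) else nothing

  span : Choice → (Fin c → Bool) → Fin N → Fin N
  span s D = lab ℓ₀ (selected s D)

  all : Fin c → Bool
  all _ = true

  selected⁺ : ∀ s D e {q} → D e ≡ true → s e ≡ just q → selected s D e ≡ just (real e q)
  selected⁺ s D e De se rewrite De | se = refl

  selected⁻ : ∀ s D e {xy} → selected s D e ≡ just xy →
    ∃ λ q → D e ≡ true × s e ≡ just q × real e q ≡ xy
  selected⁻ s D e eq with D e | s e
  ... | true | just q = q , refl , refl , just-injective eq

  span-idem : ∀ s D → Idem (span s D)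
  span-idem s D = lab-idem (selected s D) idem₀

  span-joins : ∀ s D e {q} → D e ≡ true → s e ≡ just q → Joined (span s D) (real e q)
  span-joins s D e De se = lab-joins (selected s D) e (selected⁺ s D e De se)

  Respects : Choice → (Fin c → Bool) → (Fin N → Fin N) → Set
  Respects s D g = ∀ e q → D e ≡ true → s e ≡ just q → Joined g (real e q)

  span-least : ∀ s D (g : Fin N → Fin N) → ℓ₀ ⊑ g → Respects s D g → span s D ⊑ g
  span-least s D g ℓ₀⊑g respects = lab-least (selected s D) (λ x y → g x ≡ g y) sym trans ℓ₀⊑g
    λ e sel → let q , De , se , eq = selected⁻ s D e sel in subst (Joined g) eq (respects e q De se)

  ℓ₀⊑span : ∀ s D → ℓ₀ ⊑ span s D
  ℓ₀⊑span s D = lab-⊒ (selected s D)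

  span-mono : ∀ s {D D′} → D ⊆ D′ → span s D ⊑ span s D′
  span-mono s {D} {D′} D⊆D′ = span-least s D (span s D′) (ℓ₀⊑span s D′)
    λ e q De se → span-joins s D′ e {q} (D⊆D′ e De) se

  -- A color without selected edge that leaves level s (i + 1) starts an augmenting chain of i
  -- exchanges (see augment); when the levels become stable without one, they certify optimality.
  level : Choice → ℕ → Fin c → Bool
  level s zero    = all
  level s (suc i) = inside (span s (level s i))

  level-suc-⊆ : ∀ s i → level s (suc i) ⊆ level s i
  level-suc-⊆ s zero    e _ = refl
  level-suc-⊆ s (suc i) = inside-mono (span s (level s (suc i))) (span s (level s i))
    (span-mono s (level-suc-⊆ s i))

  level-antitone : ∀ s {i j} → i ≤ j → level s j ⊆ level s i
  level-antitone s {i} {zero}  z≤n e p = p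
  level-antitone s {i} {suc j} i≤sj e p with m≤n⇒m<n∨m≡n i≤sj
  ... | inj₂ refl      = p
  ... | inj₁ (s≤s i≤j) = level-antitone s i≤j e (level-suc-⊆ s j e p)

  size : Choice → ℕ
  size s = count (is-just ∘ s)

  -- Always fixes ℓ₀ ≤ size s + fixes (span s all); equality means that no selected edge is redundant.
  Forest : Choice → Set
  Forest s = size s + fixes (span s all) ≤ fixes ℓ₀

  span-size : ∀ s D → fixes ℓ₀ ≤ fixes (span s D) + count (λ e → D e ∧ is-just (s e))
  span-size s D = ≤-trans (lab-size (selected s D) idem₀)
    (+-monoʳ-≤ (fixes (span s D)) (≤-reflexive (count-cong same)))
    where
    same : ∀ e → is-just (selected s D e) ≡ D e ∧ is-just (s e)
    same e with D e | s e
    ... | false | _       = refl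
    ... | true  | nothing = refl
    ... | true  | just _  = refl

  put : Choice → Fin c → Maybe C → Choice
  put s d v = updateAt s d (const v)

  put-≡ : ∀ s d v → put s d v d ≡ v
  put-≡ s d v = updateAt-updates d s

  put-≢ : ∀ s {d} v {e} → e ≢ d → put s d v e ≡ s e
  put-≢ s {d} v {e} e≢d = updateAt-minimal e d s e≢d

  size-put : ∀ s d q → s d ≡ nothing → size (put s d (just q)) ≡ suc (size s)
  size-put s d q sd = count-insert d (cong is-just sd) (cong is-just (put-≡ s d (just q)))
    λ e e≢d → cong is-just (sym (put-≢ s (just q) e≢d))

  size-remove : ∀ s d {q} → s d ≡ just q → size s ≡ suc (size (put s d nothing))
  size-remove s d sd = count-insert d (cong is-just (put-≡ s d nothing)) (cong is-just sd)
    λ e e≢d → cong is-just (put-≢ s nothing e≢d)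

  just≢nothing : ∀ {s : Choice} {e} {q : C} → s e ≡ just q → s e ≡ nothing → ⊥
  just≢nothing p r with trans (sym p) r
  ... | ()

  Enlargement : Choice → Set
  Enlargement s = ∃ λ t → Forest t × size t ≡ suc (size s)

  -- The new edge joins two classes of the span, so the number of classes drops while the size grows
  -- by one.
  add-crossing : ∀ s → Forest s → ∀ d q → s d ≡ nothing → ¬ Joined (span s all) (real d q) →
    Enlargement s
  add-crossing s forest d q sd crossing = t , forest′ , size-put s d q sd
    where
    t = put s d (just q)
    x = proj₁ (real d q)
    y = proj₂ (real d q)
    f = span s all
    merge⊑ : merge x y f ⊑ span t all
    merge⊑ = merge-⊑ x y f {span t all} (span-least s all (span t all) (ℓ₀⊑span t all) (λ e r _ se →
        span-joins t all e refl (trans (put-≢ s (just q) λ { refl → just≢nothing {s} se sd }) se)))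
      (span-joins t all d refl (put-≡ s d (just q)))
    forest′ : Forest t
    forest′ = begin
      size t + fixes (span t all)   ≡⟨ cong (_+ fixes (span t all)) (size-put s d q sd) ⟩
      suc (size s + fixes (span t all)) ≤⟨ s≤s (+-monoʳ-≤ (size s)
                                         (fixes-antitone {f = merge x y f} {span t all}
                                           (merge-idem x y f (span-idem s all)) merge⊑)) ⟩
      suc (size s + fixes (merge x y f)) ≡⟨ +-suc (size s) _ ⟨
      size s + suc (fixes (merge x y f)) ≤⟨ +-monoʳ-≤ (size s) (fixes-merge-< x y f (span-idem s all) crossing) ⟩
      size s + fixes f ≤⟨ forest ⟩
      fixes ℓ₀ ∎
      where open ≤-Reasoning

  -- The edge selected for the color e lies on the cycle that xy closes in span s D′.
  record OnCycle (s : Choice) (D D′ : Fin c → Bool) (xy : Fin N × Fin N) : Set where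
    field
      B      : Fin c → Bool
      e      : Fin c
      q      : C
      B⊆D′   : B ⊆ D′
      e∈B    : B e ≡ true
      e∉D    : D e ≡ false
      se     : s e ≡ just q
      closed : Joined (span s B) xy
      open′  : ¬ Joined (span s (B ∖ e)) xy

  -- Colors outside `D` are deleted one by one until `xy` is separated, which happens at the latest
  -- when only colors of `D` are left. The color whose deletion separates `xy` has a selected edge,
  -- as deleting any other color changes no span.
  on-cycle : ∀ s D D′ xy → Joined (span s D′) xy → ¬ Joined (span s D) xy → OnCycle s D D′ xy
  on-cycle s D D′ xy joined separate = go (count D′) D′ ≤-refl (λ _ p → p) joined
    where
    go : ∀ fuel B → count B ≤ fuel → B ⊆ D′ → Joined (span s B) xy → OnCycle s D D′ xy
    go fuel B size≤ B⊆D′ j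
      with any? (λ e → (B e Bool.≟ true) ×-dec (D e Bool.≟ false))
    ... | no ¬e = ⊥-elim (separate (span-mono s {B} {D} (λ e Be → ¬-not λ De → ¬e (e , Be , De)) j))
    ... | yes (e , Be , De) with joined? (span s (B ∖ e)) xy
    go zero       B size≤ B⊆D′ j | yes (e , Be , De) | yes _
      rewrite count-∖ B e Be with () ← size≤
    go (suc fuel) B size≤ B⊆D′ j | yes (e , Be , De) | yes j′ =
      go fuel (B ∖ e) (≤-pred (≤-trans (≤-reflexive (sym (count-∖ B e Be))) size≤))
        (λ d p → B⊆D′ d (proj₁ (∖-⁻ B e d p))) j′
    ... | no ¬j′ with s e in se
    ...   | just q  = record { B = B ; e = e ; q = q ; B⊆D′ = B⊆D′ ; e∈B = Be ; e∉D = De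
                             ; se = se ; closed = j ; open′ = ¬j′ }
    ...   | nothing = ⊥-elim (¬j′ (span-least s B (span s (B ∖ e)) (ℓ₀⊑span s (B ∖ e)) (λ d r Bd sd →
              span-joins s (B ∖ e) d (∖-⁺ B e d Bd λ { refl → just≢nothing {s} sd se }) sd) j))

  -- The choice `t` trades the edge `real e q` of the cycle for `real d h`, which closes it. The
  -- levels up to `suc i` do not change, so `e` becomes a color without selected edge that is
  -- missing from `level t (suc i)`: the remaining chain is shorter.
  module Exchange (s : Choice) (forest : Forest s) (i : ℕ) (d : Fin c) (h : C)
    (sd : s d ≡ nothing) (covered : ∀ e → s e ≡ nothing → level s (suc i) e ≡ true)
    (cyc : OnCycle s (level s (suc i)) (level s i) (real d h)) where

    open OnCycle cyc

    t : Choice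
    t = put (put s d (just h)) e nothing

    e≢d : e ≢ d
    e≢d refl = just≢nothing {s} se sd

    te : t e ≡ nothing
    te = put-≡ _ e nothing

    td : t d ≡ just h
    td = trans (put-≢ _ nothing (e≢d ∘ sym)) (put-≡ s d (just h))

    t-other : ∀ {b} → b ≢ d → b ≢ e → t b ≡ s b
    t-other b≢d b≢e = trans (put-≢ _ nothing b≢e) (put-≢ s (just h) b≢d)

    size-t : size t ≡ size s
    size-t = ℕ.suc-injective (trans (sym (size-remove (put s d (just h)) e {q}
               (trans (put-≢ s (just h) e≢d) se))) (size-put s d h sd))

    level∋d : ∀ {j} → j ≤ suc i → level s j d ≡ true
    level∋d j≤ = level-antitone s j≤ d (covered d sd)

    module _ {D D′ : Fin c → Bool} (level⊆D : level s i ⊆ D) (d∈D : D d ≡ true)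
             (D≗D′ : D ≗ D′) where

      -- The only selected edge lost in `t` is `real e q`. Its ends are still joined: the rest of
      -- the cycle consists of colors in `D`, and `real d h` closes the gap, by `merge-exchange`.
      span-s⊑span-t : span s D ⊑ span t D′
      span-s⊑span-t = span-least s D g (ℓ₀⊑span t D′) respects
        where
        g = span t D′
        keep : ∀ b r → b ≢ e → D b ≡ true → s b ≡ just r → Joined g (real b r)
        keep b r b≢e Db sb = span-joins t D′ b (trans (sym (D≗D′ b)) Db)
          (trans (t-other (λ { refl → just≢nothing {s} sb sd }) b≢e) sb)
        x = proj₁ (real e q)
        y = proj₂ (real e q)
        f = span s (B ∖ e)
        B⊑ : span s B ⊑ merge x y f
        B⊑ = span-least s B (merge x y f) (λ p → merge-⊒ x y f (ℓ₀⊑span s (B ∖ e) p)) respects-B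
          where
          respects-B : Respects s B (merge x y f)
          respects-B b r Bb sb with b ≟ e
          ... | no b≢e = merge-⊒ x y f (span-joins s (B ∖ e) b (∖-⁺ B e b Bb b≢e) sb)
          ... | yes refl with refl ← just-injective (trans (sym sb) se) = merge-joins x y f
        joined-e : Joined g (real e q)
        joined-e = merge-exchange x y f {g} open′ (B⊑ closed)
          (span-least s (B ∖ e) g (ℓ₀⊑span t D′) λ b r Bb sb →
            let Bb , b≢e = ∖-⁻ B e b Bb in keep b r b≢e (level⊆D b (B⊆D′ b Bb)) sb)
          (span-joins t D′ d (trans (sym (D≗D′ d)) d∈D) td)
        respects : Respects s D g
        respects b r Db sb with b ≟ e
        ... | no b≢e = keep b r b≢e Db sb
        ... | yes refl with refl ← just-injective (trans (sym sb) se) = joined-e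

      -- The only new edge is `real d h`, whose ends are already joined by the colors of `B`.
      span-t⊑span-s : span t D′ ⊑ span s D
      span-t⊑span-s = span-least t D′ (span s D) (ℓ₀⊑span s D) respects
        where
        respects : Respects t D′ (span s D)
        respects b r Db tb with b ≟ e
        ... | yes refl = ⊥-elim (just≢nothing {t} tb te)
        ... | no b≢e with b ≟ d
        ...   | no b≢d = span-joins s D b (trans (D≗D′ b) Db) (trans (sym (t-other b≢d b≢e)) tb)
        ...   | yes refl with refl ← just-injective (trans (sym tb) td) =
          Joined-mono (span s B) (span s D) (span-mono s (λ b Bb → level⊆D b (B⊆D′ b Bb))) (real d h) closed

    -- Induction on `j`: equal levels span the same partition under `s` and `t`, so the next levels
    -- agree. The cycle uses colors of `level s i`, which are available in `level s j` only for
    -- `j ≤ i`; hence the bound `suc i`.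
    level-t : ∀ {j} → j ≤ suc i → level s j ≗ level t j
    level-t {zero}  _ b = refl
    level-t {suc j} (s≤s j≤i) b = inside-cong (level s (suc j) b) (level t (suc j) b) refl refl
      where
      hyp₁ : level s i ⊆ level s j
      hyp₁ = level-antitone s j≤i
      j≤1+i = m≤n⇒m≤1+n j≤i
      inside-cong : ∀ p r → level s (suc j) b ≡ p → level t (suc j) b ≡ r → p ≡ r
      inside-cong true  r p≡ r≡ = trans (sym (inside-mono (span s (level s j)) (span t (level t j))
        (span-s⊑span-t hyp₁ (level∋d j≤1+i) (level-t j≤1+i)) b p≡)) r≡
      inside-cong false false p≡ r≡ = refl
      inside-cong false true  p≡ r≡ = trans (sym p≡) (inside-mono (span t (level t j)) (span s (level s j))
        (span-t⊑span-s hyp₁ (level∋d j≤1+i) (level-t j≤1+i)) b r≡)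

    forest-t : Forest t
    forest-t = ≤-trans (+-mono-≤ (≤-reflexive size-t)
      (fixes-antitone {f = span s all} {span t all} (span-idem s all)
        (span-s⊑span-t (λ _ _ → refl) refl (λ _ → refl)))) forest

  -- Induction on the length of the chain. A color that leaves at level 1 has an edge crossing the
  -- whole span, which can be added. Otherwise, unless another color without selected edge leaves
  -- earlier, an exchange hands the task over to a color that leaves earlier.
  augment : ∀ i s → Forest s → ∀ d → s d ≡ nothing → level s (suc i) d ≡ false → Enlargement s
  augment zero s forest d sd crossing with q , ¬j ← inside-false (span s all) d crossing =
    add-crossing s forest d q sd ¬j
  augment (suc i) s forest d sd crossing
    with any? (λ e → Maybe-nothing? (s e) ×-dec (level s (suc i) e Bool.≟ false))
    where
    Maybe-nothing? : (v : Maybe C) → Dec (v ≡ nothing)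
    Maybe-nothing? nothing  = yes refl
    Maybe-nothing? (just _) = no λ ()
  ... | yes (e , se , e∉) = augment i s forest e se e∉
  -- The realization `h` crosses the span of `level s (suc i)`. As `d` still belongs to that level,
  -- `h` is joined in the span of `level s i`, so it closes a cycle there.
  ... | no ¬e with h , ¬j ← inside-false (span s (level s (suc i))) d crossing =
    let t , forest′ , size′ = augment i X.t X.forest-t Y.e X.te
          (trans (sym (X.level-t ≤-refl Y.e)) Y.e∉D)
    in t , forest′ , trans size′ (cong suc X.size-t)
    where
    covered : ∀ e → s e ≡ nothing → level s (suc i) e ≡ true
    covered e se = ¬-not λ e∉ → ¬e (e , se , e∉)
    cyc = on-cycle s (level s (suc i)) (level s i) (real d h) (inside⁻ (span s (level s i)) d (covered d sd) h) ¬j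
    module Y = OnCycle cyc
    module X = Exchange s forest i d h sd covered cyc

  Connecting : Choice → Set
  Connecting s = ∀ x y → span s all x ≡ span s all y

  -- The hypothesis is Rado's condition: a partition into q classes, coarser than `ℓ₀`, is crossed
  -- by at least q - 1 colors.
  module Theorem (cond : ∀ f → Idem f → ℓ₀ ⊑ f → fixes f ≤ suc (count (λ e → ⌊ crosses? f e ⌋))) where

    -- The colors crossing span s D are exactly those outside D, and all of them are in use.
    stable : ∀ s → Forest s → ∀ i → level s i ⊆ level s (suc i) →
      (∀ e → s e ≡ nothing → level s (suc i) e ≡ true) → fixes (span s all) ≤ 1
    stable s forest i stab covered = +-cancelˡ-≤ (size s) _ _ (begin
      size s + fixes (span s all)               ≤⟨ forest ⟩
      fixes ℓ₀                                  ≤⟨ span-size s D ⟩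
      fixes f + count kept                      ≤⟨ +-monoˡ-≤ (count kept) (cond f (span-idem s D) (ℓ₀⊑span s D)) ⟩
      suc (count (λ e → ⌊ crosses? f e ⌋) + count kept) ≤⟨ s≤s (count-disjoint disjoint used λ e → ∧-true₂ (D e)) ⟩
      suc (size s)                              ≡⟨ +-comm 1 (size s) ⟩
      size s + 1                                ∎)
      where
      open ≤-Reasoning
      D = level s i
      f = span s D
      kept : Fin c → Bool
      kept e = D e ∧ is-just (s e)
      ∧-true₂ : ∀ x {y} → x ∧ y ≡ true → y ≡ true
      ∧-true₂ true p = p
      outside : ∀ e → ⌊ crosses? f e ⌋ ≡ true → level s (suc i) e ≡ false
      outside e p rewrite p = refl
      disjoint : ∀ e → ⌊ crosses? f e ⌋ ≡ true → kept e ≡ false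
      disjoint e p with D e in De
      ... | false = refl
      ... | true  = ⊥-elim (true≢false (stab e De) (outside e p))
      used : ∀ e → ⌊ crosses? f e ⌋ ≡ true → is-just (s e) ≡ true
      used e p with s e in se
      ... | just _  = refl
      ... | nothing = ⊥-elim (true≢false (covered e se) (outside e p))

    -- The levels decrease, so eventually either a color without selected edge leaves and `augment`
    -- applies, or two consecutive levels agree and `stable` applies. The fuel bounds the size of
    -- the current level.
    improve : ∀ s → Forest s → fixes (span s all) ≤ 1 ⊎ Enlargement s
    improve s forest = go (count (level s 0)) 0 ≤-refl
      where
      go : ∀ fuel i → count (level s i) ≤ fuel → fixes (span s all) ≤ 1 ⊎ Enlargement s
      go fuel i size≤
        with any? (λ e → (is-just (s e) Bool.≟ false) ×-dec (level s (suc i) e Bool.≟ false))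
      ... | yes (e , se , e∉) = inj₂ (augment i s forest e (is-nothing se) e∉)
        where
        is-nothing : {v : Maybe C} → is-just v ≡ false → v ≡ nothing
        is-nothing {nothing} _ = refl
      ... | no ¬e with any? (λ e → (level s i e Bool.≟ true) ×-dec (level s (suc i) e Bool.≟ false))
      ...   | no ¬drop = inj₁ (stable s forest i (λ e p → ¬-not λ e∉ → ¬drop (e , p , e∉))
                λ e se → ¬-not λ e∉ → ¬e (e , cong is-just se , e∉))
      go zero i size≤ | no _ | yes (e , p , e∉) rewrite count-∖ (level s i) e p with () ← size≤
      go (suc fuel) i size≤ | no _ | yes (e , p , e∉) = go fuel (suc i)
        (≤-trans (count-mono λ d d∈ → ∖-⁺ (level s i) e d (level-suc-⊆ s i d d∈)
                   λ { refl → true≢false d∈ e∉ })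
          (≤-pred (≤-trans (≤-reflexive (sym (count-∖ (level s i) e p))) size≤)))

    enlarge : ∀ fuel s → Forest s → c ≤ fuel + size s → ∃ λ t → fixes (span t all) ≤ 1
    enlarge fuel s forest c≤ with improve s forest
    ... | inj₁ done = s , done
    enlarge zero s forest c≤ | inj₂ (t , _ , eq) =
      ⊥-elim (<⇒≱ (≤-trans (s≤s c≤) (≤-reflexive (sym eq))) (count≤ (is-just ∘ t)))
    enlarge (suc fuel) s forest c≤ | inj₂ (t , forest′ , eq) = enlarge fuel t forest′
      (≤-trans c≤ (≤-reflexive (trans (sym (+-suc fuel _)) (cong (fuel +_) (sym eq)))))

    rainbow : ∃ Connecting
    rainbow with s , ≤1 ← enlarge c (const nothing) (≤-trans
          (≤-reflexive (cong (_+ fixes (span (const nothing) all))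
            (count-none {a = c} {P = λ _ → false} λ _ → refl)))
          (fixes-antitone {f = ℓ₀} {span (const nothing) all} idem₀ (ℓ₀⊑span (const nothing) all)))
          (m≤m+n c _)
      = s , λ x y → count≤1⇒unique (fixed (span s all)) ≤1 _ _
          (⌊⌋⁺ (_ ≟ _) (span-idem s all x)) (⌊⌋⁺ (_ ≟ _) (span-idem s all y))

-- Sums and indicators

𝟙 : Bool → ℕ
𝟙 x = if x then 1 else 0

count≡sum : (P : Fin a → Bool) → count P ≡ sum (𝟙 ∘ P)
count≡sum {zero}  P = refl
count≡sum {suc a} P = cong (𝟙 (P zero) +_) (count≡sum (P ∘ suc))

sum-mono : {f g : Fin a → ℕ} → (∀ i → f i ≤ g i) → sum f ≤ sum g
sum-mono {zero}  f≤g = z≤n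
sum-mono {suc a} f≤g = +-mono-≤ (f≤g zero) (sum-mono (f≤g ∘ suc))

sum-zero : {f : Fin a → ℕ} → (∀ i → f i ≤ 0) → sum f ≤ 0
sum-zero {zero}  f≤0 = z≤n
sum-zero {suc a} f≤0 = +-mono-≤ (f≤0 zero) (sum-zero (f≤0 ∘ suc))

term≤sum : (f : Fin a → ℕ) (i : Fin a) → f i ≤ sum f
term≤sum f zero    = m≤m+n _ _
term≤sum f (suc i) = ≤-trans (term≤sum (f ∘ suc) i) (m≤n+m _ _)

sum-point : (x : Fin a) (f : Fin a → ℕ) → sum (λ v → 𝟙 ⌊ x ≟ v ⌋ * f v) ≤ f x
sum-point {suc a} zero    f = ≤-trans
  (+-monoʳ-≤ (f zero + 0) (sum-zero {f = λ v → 𝟙 ⌊ zero ≟ suc v ⌋ * f (suc v)} λ v → ≤-refl))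
  (≤-reflexive (trans (+-identityʳ _) (+-identityʳ _)))
sum-point {suc a} (suc x) f = ≤-trans (sum-mono {g = λ v → 𝟙 ⌊ x ≟ v ⌋ * f (suc v)} shift) (sum-point x (f ∘ suc))
  where
  shift : ∀ v → 𝟙 ⌊ suc x ≟ suc v ⌋ * f (suc v) ≤ 𝟙 ⌊ x ≟ v ⌋ * f (suc v)
  shift v with x ≟ v
  ... | yes _ = ≤-refl
  ... | no  _ = ≤-refl

∨-true : ∀ x {y} → x ∨ y ≡ true → x ≡ true ⊎ y ≡ true
∨-true true  _ = inj₁ refl
∨-true false p = inj₂ p

∨-trueʳ : ∀ x {y} → y ≡ true → x ∨ y ≡ true
∨-trueʳ true  _ = refl
∨-trueʳ false p = p

∧-true : ∀ x {y} → x ∧ y ≡ true → x ≡ true × y ≡ true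
∧-true true p = refl , p

∧-intro : ∀ {x y} → x ≡ true → y ≡ true → x ∧ y ≡ true
∧-intro refl p = p

-- Edge cuts and degrees

module Cuts (G : Graph) where

  src tgt : Fin (k G) → Fin (n G)
  src e = proj₁ (ends G e)
  tgt e = proj₂ (ends G e)

  reach-invariant : {X : EdgeSet G} (f : Fin (n G) → A) → (∀ e → X e ≡ true → f (src e) ≡ f (tgt e)) →
    ∀ {x y} → Reach G X x y → f x ≡ f y
  reach-invariant f inv here = refl
  reach-invariant f inv (step e Xe (inj₁ eq) r) =
    trans (subst (λ p → f (proj₁ p) ≡ f (proj₂ p)) eq (inv e Xe))
    (reach-invariant f inv r)
  reach-invariant f inv (step e Xe (inj₂ eq) r) =
    trans (sym (subst (λ p → f (proj₁ p) ≡ f (proj₂ p)) eq (inv e Xe)))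
    (reach-invariant f inv r)

  boundary : (Fin (n G) → Bool) → EdgeSet G
  boundary Y e = Y (src e) xor Y (tgt e)

  -- If fewer than `l` edges left `Y`, deleting them would keep the graph connected, yet membership
  -- in `Y` is constant along the remaining edges.
  cut-size : ∀ {l} → EdgeConnected l G → (Y : Fin (n G) → Bool) → ∀ x y → Y x ≡ true → Y y ≡ false →
    l ≤ count (boundary Y)
  cut-size {l} conn Y x y Yx Yy with l ≤? count (boundary Y)
  ... | yes l≤ = l≤
  ... | no  l≰ = ⊥-elim (true≢false Yx (trans
      (reach-invariant Y (λ e → same (Y (src e)) (Y (tgt e))) (conn (boundary Y) (≰⇒> l≰) x y)) Yy))
    where
    same : ∀ p q → not (p xor q) ≡ true → p ≡ q
    same true  true  _ = refl
    same false false _ = refl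

  incident : Fin (k G) → Fin (n G) → Bool
  incident e v = ⌊ src e ≟ v ⌋ ∨ ⌊ tgt e ≟ v ⌋

  incident⁻ : ∀ e v → incident e v ≡ true → src e ≡ v ⊎ tgt e ≡ v
  incident⁻ e v p with ∨-true ⌊ src e ≟ v ⌋ p
  ... | inj₁ q = inj₁ (⌊⌋⁻ (src e ≟ v) q)
  ... | inj₂ q = inj₂ (⌊⌋⁻ (tgt e ≟ v) q)

  -- The cut around `v` consists of edges at `v`; the second vertex `u` makes it a proper cut.
  deg≥ : ∀ {l} → EdgeConnected l G → ∀ u v → v ≢ u → l ≤ degG G v
  deg≥ conn u v v≢u = ≤-trans
    (cut-size conn (λ w → ⌊ v ≟ w ⌋) v u (⌊⌋⁺ (v ≟ v) refl) (⌊⌋⁺ᶠ (v ≟ u) v≢u))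
    (count-mono incidence)
    where
    ∨-intro : ∀ {p q p′ q′} → p ≡ p′ → q ≡ q′ → p xor q ≡ true → p′ ∨ q′ ≡ true
    ∨-intro {true}          refl refl _ = refl
    ∨-intro {false} {true}  refl refl _ = refl
    flip : ∀ w → ⌊ v ≟ w ⌋ ≡ ⌊ w ≟ v ⌋
    flip w with v ≟ w
    ... | yes v≡w = sym (⌊⌋⁺ (w ≟ v) (sym v≡w))
    ... | no  v≢w = sym (⌊⌋⁺ᶠ (w ≟ v) (v≢w ∘ sym))
    incidence : boundary (λ w → ⌊ v ≟ w ⌋) ⊆ (λ e → true ∧ incident e v)
    incidence e = ∨-intro (flip (src e)) (flip (tgt e))

-- The counting bound for a partition and a vertex set

module PartitionBound (G : Graph) (m : ℕ) (conn : EdgeConnected (2 * m) G)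
  (M : EdgeSet G) (M≤m : MaxDegLe G M m)
  (u : Fin (n G)) (p : Fin (n G) → ℕ)
  (p-u : 2 * p u ≤ suc (degG G u)) (p-v : ∀ v → v ≢ u → 2 * p v + 2 * m ≤ degG G v)
  (g : Fin (n G) → Fin (n G)) (g-idem : Idem g) (S : Fin (n G) → Bool) where

  open Cuts G

  crossing touching : EdgeSet G
  crossing e = not ⌊ g (src e) ≟ g (tgt e) ⌋
  touching e = S (src e) ∨ S (tgt e)

  -- Among the edges that cross the partition or touch `S`, the lost ones are exactly those that are
  -- not usable.
  usable lost : EdgeSet G
  usable e = crossing e ∨ (not (M e) ∧ touching e)
  lost   e = M e ∧ touching e ∧ ⌊ g (src e) ≟ g (tgt e) ⌋

  -- The set X ∖ S, where X is the block with label `r`.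
  rest : Fin (n G) → Fin (n G) → Bool
  rest r v = ⌊ g v ≟ r ⌋ ∧ not (S v)

  swallowed? : ∀ r → Dec (∀ v → rest r v ≡ false)
  swallowed? r = all? λ v → rest r v Bool.≟ false

  -- Marks only the representative of each block contained in `S`: this counts such blocks and at
  -- the same time gives a subset of `S`.
  swallowed : Fin (n G) → Bool
  swallowed r = fixed g r ∧ ⌊ swallowed? r ⌋

  S∖swallowed : Fin (n G) → Bool
  S∖swallowed v = S v ∧ not (swallowed v)

  swallowed-block : ∀ r v → swallowed r ≡ true → g v ≡ r → S v ≡ true
  swallowed-block r v sw gv≡r with _ , sw ← ∧-true (fixed g r) sw
    with ⌊⌋⁻ (swallowed? r) sw v
  ... | eq rewrite ⌊⌋⁺ (g v ≟ r) gv≡r with S v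
  ...   | true = refl

  swallowed-rep : ∀ r → swallowed r ≡ true → g r ≡ r
  swallowed-rep r sw = ⌊⌋⁻ (g r ≟ r) (proj₁ (∧-true (fixed g r) sw))

  vertexTerm restTerm : Fin (k G) → Fin (n G) → ℕ
  vertexTerm e v = 𝟙 (S v) * 𝟙 (incident e v)
  restTerm   e v = 𝟙 (fixed g v) * 𝟙 (boundary (rest v) e)

  -- Each end of `e` is counted at most once: through its degree if it lies in `S`, and otherwise
  -- through the boundary of the rest of its block.
  edge-bound-two : ∀ e → sum (λ v → vertexTerm e v + restTerm e v) ≤ 2
  edge-bound-two e = begin
    sum (λ v → vertexTerm e v + restTerm e v)
      ≤⟨ sum-mono (λ v → +-mono-≤ (vertex≤ v) (rest≤ v)) ⟩
    sum (λ v → (at α S v + at β S v) + (at (g α) S′ v + at (g β) S″ v))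
      ≡⟨ ∑-distrib-+ (λ v → at α S v + at β S v) (λ v → at (g α) S′ v + at (g β) S″ v) ⟩
    sum (λ v → at α S v + at β S v) + sum (λ v → at (g α) S′ v + at (g β) S″ v)
      ≡⟨ cong₂ _+_ (∑-distrib-+ (at α S) (at β S)) (∑-distrib-+ (at (g α) S′) (at (g β) S″)) ⟩
    (sum (at α S) + sum (at β S)) + (sum (at (g α) S′) + sum (at (g β) S″))
      ≤⟨ +-mono-≤ (+-mono-≤ (sum-point α (𝟙 ∘ S)) (sum-point β (𝟙 ∘ S)))
                  (+-mono-≤ (sum-point (g α) (𝟙 ∘ S′)) (sum-point (g β) (𝟙 ∘ S″))) ⟩
    (𝟙 (S α) + 𝟙 (S β)) + (𝟙 (not (S α)) + 𝟙 (not (S β)))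
      ≡⟨ total (S α) (S β) ⟩
    2 ∎
    where
    open ≤-Reasoning
    α β : Fin (n G)
    α = src e
    β = tgt e
    -- These are constant because `sum-point` evaluates them at the labels `g α` and `g β`, while
    -- the condition concerns the ends `α` and `β`.
    S′ S″ : Fin (n G) → Bool
    S′ _ = not (S α)
    S″ _ = not (S β)
    at : Fin (n G) → (Fin (n G) → Bool) → Fin (n G) → ℕ
    at x P v = 𝟙 ⌊ x ≟ v ⌋ * 𝟙 (P v)
    total : ∀ x y → (𝟙 x + 𝟙 y) + (𝟙 (not x) + 𝟙 (not y)) ≡ 2
    total true  true  = refl
    total true  false = refl
    total false true  = refl
    total false false = refl
    vertex≤ : ∀ v → vertexTerm e v ≤ at α S v + at β S v
    vertex≤ v with S v | ⌊ α ≟ v ⌋ | ⌊ β ≟ v ⌋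
    ... | false | _     | _     = z≤n
    ... | true  | true  | _     = s≤s z≤n
    ... | true  | false | true  = ≤-refl
    ... | true  | false | false = z≤n
    rest≤ : ∀ v → restTerm e v ≤ at (g α) S′ v + at (g β) S″ v
    rest≤ v with fixed g v | ⌊ g α ≟ v ⌋ | ⌊ g β ≟ v ⌋ | S α | S β
    ... | false | _     | _     | _     | _     = z≤n
    ... | true  | true  | _     | false | _     =
      ≤-trans (≤-reflexive (+-identityʳ _)) (≤-trans (𝟙≤1 _) (m≤m+n 1 _))
      where
      𝟙≤1 : ∀ x → 𝟙 x ≤ 1
      𝟙≤1 true  = ≤-refl
      𝟙≤1 false = z≤n
    ... | true  | true  | true  | true  | false = ≤-refl
    ... | true  | true  | true  | true  | true  = z≤n
    ... | true  | true  | false | true  | _     = z≤n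
    ... | true  | false | true  | _     | false = ≤-refl
    ... | true  | false | true  | _     | true  = z≤n
    ... | true  | false | false | _     | _     = z≤n

  -- Both ends lie outside `S` and in the same block, so `e` leaves no rest.
  edge-bound-zero : ∀ e → crossing e ∨ touching e ≡ false → sum (λ v → vertexTerm e v + restTerm e v) ≤ 0
  edge-bound-zero e eq = sum-zero λ v → ≤-reflexive (cong₂ _+_ (vertex-zero v) (rest-zero v))
    where
    separate : ∀ x y z → not x ∨ (y ∨ z) ≡ false → x ≡ true × y ≡ false × z ≡ false
    separate true false false _ = refl , refl , refl
    parts = separate ⌊ g (src e) ≟ g (tgt e) ⌋ (S (src e)) (S (tgt e)) eq
    ga≡gb = ⌊⌋⁻ (g (src e) ≟ g (tgt e)) (proj₁ parts)
    Ss = proj₁ (proj₂ parts)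
    St = proj₂ (proj₂ parts)
    vertex-zero : ∀ v → vertexTerm e v ≡ 0
    vertex-zero v with incident e v in inc
    ... | false = *-zeroʳ (𝟙 (S v))
    ... | true with incident⁻ e v inc
    ...   | inj₁ refl rewrite Ss = refl
    ...   | inj₂ refl rewrite St = refl
    rest-zero : ∀ v → restTerm e v ≡ 0
    rest-zero v rewrite Ss | St | ga≡gb with ⌊ g (tgt e) ≟ v ⌋
    ... | true  = *-zeroʳ (𝟙 (fixed g v))
    ... | false = *-zeroʳ (𝟙 (fixed g v))

  edge-bound : ∀ e → sum (λ v → vertexTerm e v + restTerm e v) ≤ 2 * 𝟙 (crossing e ∨ touching e)
  edge-bound e with crossing e ∨ touching e in eq
  ... | true  = edge-bound-two e
  ... | false = edge-bound-zero e eq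

  degreeSum : ℕ
  degreeSum = sum λ v → 𝟙 (S v) * degG G v

  sum-edges : (w : Fin (n G) → ℕ) (I : Fin (k G) → Fin (n G) → Bool) →
    sum (λ v → w v * count (λ e → I e v)) ≡ sum (λ e → sum (λ v → w v * 𝟙 (I e v)))
  sum-edges w I = trans
    (sum-cong-≗ λ v → trans (cong (w v *_) (count≡sum (λ e → I e v))) (*-distribˡ-sum (w v) (λ e → 𝟙 (I e v))))
    (∑-comm λ v e → w v * 𝟙 (I e v))

  -- Exchanging the order of summation leaves the contribution of a single edge, bounded by
  -- `edge-bound`.
  double-count : degreeSum + sum (λ v → 𝟙 (fixed g v) * count (boundary (rest v)))
    ≤ 2 * count (λ e → crossing e ∨ touching e)
  double-count = begin
    degreeSum + sum (λ v → 𝟙 (fixed g v) * count (boundary (rest v)))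
      ≡⟨ cong₂ _+_ (sum-edges (𝟙 ∘ S) incident) (sum-edges (𝟙 ∘ fixed g) (λ e v → boundary (rest v) e)) ⟩
    sum (λ e → sum (vertexTerm e)) + sum (λ e → sum (restTerm e))
      ≡⟨ ∑-distrib-+ (λ e → sum (vertexTerm e)) (λ e → sum (restTerm e)) ⟨
    sum (λ e → sum (vertexTerm e) + sum (restTerm e))
      ≡⟨ sum-cong-≗ (λ e → sym (∑-distrib-+ (vertexTerm e) (restTerm e))) ⟩
    sum (λ e → sum (λ v → vertexTerm e v + restTerm e v))
      ≤⟨ sum-mono edge-bound ⟩
    sum (λ e → 2 * 𝟙 (crossing e ∨ touching e))
      ≡⟨ *-distribˡ-sum 2 (λ e → 𝟙 (crossing e ∨ touching e)) ⟨
    2 * sum (λ e → 𝟙 (crossing e ∨ touching e))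
      ≡⟨ cong (2 *_) (count≡sum (λ e → crossing e ∨ touching e)) ⟨
    2 * count (λ e → crossing e ∨ touching e) ∎
    where open ≤-Reasoning

  -- Every lost edge is charged to an end in `S∖swallowed`, and each vertex receives at most its
  -- degree in `M`.
  lost-bound : count lost ≤ m * count S∖swallowed
  lost-bound = begin
    count lost                                            ≡⟨ count≡sum lost ⟩
    sum (𝟙 ∘ lost)                                        ≤⟨ sum-mono charge ⟩
    sum (λ e → sum (λ v → 𝟙 (S∖swallowed v) * 𝟙 (M e ∧ incident e v)))
      ≡⟨ sum-edges (𝟙 ∘ S∖swallowed) (λ e v → M e ∧ incident e v) ⟨
    sum (λ v → 𝟙 (S∖swallowed v) * deg G M v)
      ≤⟨ sum-mono (λ v → *-monoʳ-≤ (𝟙 (S∖swallowed v)) (M≤m v)) ⟩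
    sum (λ v → 𝟙 (S∖swallowed v) * m)                     ≡⟨ sum-cong-≗ (λ v → *-comm (𝟙 (S∖swallowed v)) m) ⟩
    sum (λ v → m * 𝟙 (S∖swallowed v))                     ≡⟨ *-distribˡ-sum m (𝟙 ∘ S∖swallowed) ⟨
    m * sum (𝟙 ∘ S∖swallowed)                             ≡⟨ cong (m *_) (count≡sum S∖swallowed) ⟨
    m * count S∖swallowed                                 ∎
    where
    open ≤-Reasoning
    -- An edge of M inside a block that lies in S has an end other than the representative.
    charged : ∀ e → touching e ≡ true → g (src e) ≡ g (tgt e) → ∃ λ v → S∖swallowed v ≡ true × incident e v ≡ true
    charged e touch ga≡gb = by-cases (swallowed (src e)) (swallowed (tgt e)) refl refl
      where
      at-src : S (src e) ≡ true → swallowed (src e) ≡ false → ∃ λ v → S∖swallowed v ≡ true × incident e v ≡ true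
      at-src Sa sw = src e , ∧-intro Sa (cong not sw) , cong (_∨ ⌊ tgt e ≟ src e ⌋) (⌊⌋⁺ (src e ≟ src e) refl)
      at-tgt : S (tgt e) ≡ true → swallowed (tgt e) ≡ false → ∃ λ v → S∖swallowed v ≡ true × incident e v ≡ true
      at-tgt Sb sw = tgt e , ∧-intro Sb (cong not sw) , ∨-trueʳ ⌊ src e ≟ tgt e ⌋ (⌊⌋⁺ (tgt e ≟ tgt e) refl)
      by-cases : ∀ x y → swallowed (src e) ≡ x → swallowed (tgt e) ≡ y →
        ∃ λ v → S∖swallowed v ≡ true × incident e v ≡ true
      -- Two representatives of the same block coincide, which would make `e` a loop.
      by-cases true true sa sb = ⊥-elim (loopless G e
        (trans (sym (swallowed-rep (src e) sa)) (trans ga≡gb (swallowed-rep (tgt e) sb))))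
      by-cases true false sa sb =
        at-tgt (swallowed-block (src e) (tgt e) sa (trans (sym ga≡gb) (swallowed-rep (src e) sa))) sb
      by-cases false true sa sb =
        at-src (swallowed-block (tgt e) (src e) sb (trans ga≡gb (swallowed-rep (tgt e) sb))) sa
      by-cases false false sa sb with ∨-true (S (src e)) touch
      ... | inj₁ Sa = at-src Sa sa
      ... | inj₂ Sb = at-tgt Sb sb
    charge : ∀ e → 𝟙 (lost e) ≤ sum (λ v → 𝟙 (S∖swallowed v) * 𝟙 (M e ∧ incident e v))
    charge e with lost e in le
    ... | false = z≤n
    ... | true =
      let Me , rest-le = ∧-true (M e) le
          touch , same = ∧-true (touching e) rest-le
          v , Sv , inc = charged e touch (⌊⌋⁻ (g (src e) ≟ g (tgt e)) same)
      in ≤-trans (≤-reflexive (sym (cong₂ (λ x y → 𝟙 x * 𝟙 y) Sv (∧-intro Me inc))))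
           (term≤sum (λ v → 𝟙 (S∖swallowed v) * 𝟙 (M e ∧ incident e v)) v)

  usable+lost : count (λ e → crossing e ∨ touching e) ≤ count usable + count lost
  usable+lost = begin
    count (λ e → crossing e ∨ touching e)      ≡⟨ count≡sum (λ e → crossing e ∨ touching e) ⟩
    sum (λ e → 𝟙 (crossing e ∨ touching e))    ≤⟨ sum-mono split ⟩
    sum (λ e → 𝟙 (usable e) + 𝟙 (lost e))      ≡⟨ ∑-distrib-+ (𝟙 ∘ usable) (𝟙 ∘ lost) ⟩
    sum (𝟙 ∘ usable) + sum (𝟙 ∘ lost)          ≡⟨ cong₂ _+_ (count≡sum usable) (count≡sum lost) ⟨
    count usable + count lost                  ∎
    where
    open ≤-Reasoning
    split : ∀ e → 𝟙 (crossing e ∨ touching e) ≤ 𝟙 (usable e) + 𝟙 (lost e)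
    split e with ⌊ g (src e) ≟ g (tgt e) ⌋ | touching e | M e
    ... | false | _     | _     = s≤s z≤n
    ... | true  | false | _     = z≤n
    ... | true  | true  | false = ≤-refl
    ... | true  | true  | true  = ≤-refl

  blocks-split : fixes g ≤ count swallowed + count (λ r → fixed g r ∧ not ⌊ swallowed? r ⌋)
  blocks-split = begin
    fixes g                    ≡⟨ count≡sum (fixed g) ⟩
    sum (𝟙 ∘ fixed g)          ≤⟨ sum-mono split ⟩
    sum (λ r → 𝟙 (swallowed r) + 𝟙 (fixed g r ∧ not ⌊ swallowed? r ⌋))
      ≡⟨ ∑-distrib-+ (𝟙 ∘ swallowed) (λ r → 𝟙 (fixed g r ∧ not ⌊ swallowed? r ⌋)) ⟩
    sum (𝟙 ∘ swallowed) + sum (λ r → 𝟙 (fixed g r ∧ not ⌊ swallowed? r ⌋))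
      ≡⟨ cong₂ _+_ (count≡sum swallowed) (count≡sum (λ r → fixed g r ∧ not ⌊ swallowed? r ⌋)) ⟨
    count swallowed + count (λ r → fixed g r ∧ not ⌊ swallowed? r ⌋) ∎
    where
    open ≤-Reasoning
    split : ∀ r → 𝟙 (fixed g r) ≤ 𝟙 (swallowed r) + 𝟙 (fixed g r ∧ not ⌊ swallowed? r ⌋)
    split r with fixed g r | ⌊ swallowed? r ⌋
    ... | false | _     = z≤n
    ... | true  | true  = ≤-refl
    ... | true  | false = ≤-refl

  S-split : count swallowed + count S∖swallowed ≤ count S
  S-split = count-disjoint disjoint (λ r sw → swallowed-block r r sw (swallowed-rep r sw))
    (λ v p → proj₁ (∧-true (S v) p))
    where
    disjoint : ∀ r → swallowed r ≡ true → S∖swallowed r ≡ false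
    disjoint r sw rewrite sw with S r
    ... | true  = refl
    ... | false = refl

  -- A block that is not swallowed has a nonempty rest; by assumption this is also not the whole
  -- vertex set, so its cut has at least `2 * m` edges.
  rest-cuts : (∀ r → ∃ λ y → rest r y ≡ false) →
    2 * m * count (λ r → fixed g r ∧ not ⌊ swallowed? r ⌋) ≤ sum (λ v → 𝟙 (fixed g v) * count (boundary (rest v)))
  rest-cuts proper = begin
    2 * m * count (λ r → fixed g r ∧ not ⌊ swallowed? r ⌋)
      ≡⟨ cong (2 * m *_) (count≡sum (λ r → fixed g r ∧ not ⌊ swallowed? r ⌋)) ⟩
    2 * m * sum (λ r → 𝟙 (fixed g r ∧ not ⌊ swallowed? r ⌋))
      ≡⟨ *-distribˡ-sum (2 * m) (λ r → 𝟙 (fixed g r ∧ not ⌊ swallowed? r ⌋)) ⟩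
    sum (λ r → 2 * m * 𝟙 (fixed g r ∧ not ⌊ swallowed? r ⌋))
      ≤⟨ sum-mono cut ⟩
    sum (λ v → 𝟙 (fixed g v) * count (boundary (rest v))) ∎
    where
    open ≤-Reasoning
    cut : ∀ r → 2 * m * 𝟙 (fixed g r ∧ not ⌊ swallowed? r ⌋) ≤ 𝟙 (fixed g r) * count (boundary (rest r))
    cut r with fixed g r | swallowed? r
    ... | false | _     = ≤-reflexive (*-zeroʳ (2 * m))
    ... | true  | yes _ = ≤-trans (≤-reflexive (*-zeroʳ (2 * m))) z≤n
    ... | true  | no ¬sw with any? (λ v → rest r v Bool.≟ true)
    ...   | no ¬v = ⊥-elim (¬sw λ v → ¬-not λ rv → ¬v (v , rv))
    ...   | yes (v , rv) = begin
      2 * m * 1                        ≡⟨ *-identityʳ (2 * m) ⟩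
      2 * m                            ≤⟨ cut-size conn (rest r) v (proj₁ (proper r)) rv (proj₂ (proper r)) ⟩
      count (boundary (rest r))        ≡⟨ +-identityʳ _ ⟨
      count (boundary (rest r)) + 0    ∎

  -- A swallowed block lacks its `2 * m` cut edges, and the lost edges, counted twice, cost `2 * m`
  -- for each vertex of `S∖swallowed`. By `S-split` both deficits together are at most
  -- `2 * m * count S`.
  degree-bound : (∀ r → ∃ λ y → rest r y ≡ false) →
    degreeSum + 2 * m * fixes g ≤ 2 * count usable + 2 * m * count S
  degree-bound proper = begin
    degreeSum + 2 * m * fixes g
      ≤⟨ +-monoʳ-≤ degreeSum (*-monoʳ-≤ (2 * m) blocks-split) ⟩
    degreeSum + 2 * m * (sw + unsw)
      ≡⟨ regroup degreeSum m sw unsw ⟩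
    degreeSum + 2 * m * unsw + 2 * m * sw
      ≤⟨ +-monoˡ-≤ (2 * m * sw) (≤-trans (+-monoʳ-≤ degreeSum (rest-cuts proper)) double-count) ⟩
    2 * count (λ e → crossing e ∨ touching e) + 2 * m * sw
      ≤⟨ +-monoˡ-≤ (2 * m * sw) (*-monoʳ-≤ 2 (≤-trans usable+lost (+-monoʳ-≤ (count usable) lost-bound))) ⟩
    2 * (count usable + m * S′) + 2 * m * sw
      ≡⟨ regroup′ (count usable) m S′ sw ⟩
    2 * count usable + 2 * m * (sw + S′)
      ≤⟨ +-monoʳ-≤ (2 * count usable) (*-monoʳ-≤ (2 * m) S-split) ⟩
    2 * count usable + 2 * m * count S ∎
    where
    open ≤-Reasoning
    sw unsw S′ : ℕ
    sw = count swallowed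
    unsw = count (λ r → fixed g r ∧ not ⌊ swallowed? r ⌋)
    S′ = count S∖swallowed
    regroup : ∀ d m x y → d + 2 * m * (x + y) ≡ d + 2 * m * y + 2 * m * x
    regroup = solve-∀
    regroup′ : ∀ r m x y → 2 * (r + m * x) + 2 * m * y ≡ 2 * r + 2 * m * (y + x)
    regroup′ = solve-∀

  demand : ℕ
  demand = sum λ v → 𝟙 (S v) * p v

  -- Away from `u` the hypothesis `p-v` compares the terms vertex by vertex; at `u` the hypothesis
  -- `p-u` leaves an excess of at most `suc (2 * m)`.
  demand-bound : 2 * demand + 2 * m * count S ≤ degreeSum + suc (2 * m)
  demand-bound = begin
    2 * demand + 2 * m * count S
      ≡⟨ cong₂ _+_ (*-distribˡ-sum 2 (λ v → 𝟙 (S v) * p v))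
           (trans (cong (2 * m *_) (count≡sum S)) (*-distribˡ-sum (2 * m) (𝟙 ∘ S))) ⟩
    sum (λ v → 2 * (𝟙 (S v) * p v)) + sum (λ v → 2 * m * 𝟙 (S v))
      ≡⟨ ∑-distrib-+ (λ v → 2 * (𝟙 (S v) * p v)) (λ v → 2 * m * 𝟙 (S v)) ⟨
    sum (λ v → 2 * (𝟙 (S v) * p v) + 2 * m * 𝟙 (S v))
      ≤⟨ sum-mono local ⟩
    sum (λ v → 𝟙 (S v) * degG G v + 𝟙 ⌊ u ≟ v ⌋ * suc (2 * m))
      ≡⟨ ∑-distrib-+ (λ v → 𝟙 (S v) * degG G v) (λ v → 𝟙 ⌊ u ≟ v ⌋ * suc (2 * m)) ⟩
    degreeSum + sum (λ v → 𝟙 ⌊ u ≟ v ⌋ * suc (2 * m))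
      ≤⟨ +-monoʳ-≤ degreeSum (sum-point u (const (suc (2 * m)))) ⟩
    degreeSum + suc (2 * m) ∎
    where
    open ≤-Reasoning
    inS : ∀ q d → 2 * (1 * q) + 2 * m * 1 ≡ 2 * q + 2 * m
    inS q d = cong₂ (λ x y → 2 * x + y) (*-identityˡ q) (*-identityʳ (2 * m))
    local : ∀ v → 2 * (𝟙 (S v) * p v) + 2 * m * 𝟙 (S v) ≤ 𝟙 (S v) * degG G v + 𝟙 ⌊ u ≟ v ⌋ * suc (2 * m)
    local v with S v
    ... | false = ≤-trans (≤-reflexive (*-zeroʳ (2 * m))) z≤n
    ... | true with u ≟ v
    ...   | no u≢v = begin
      2 * (1 * p v) + 2 * m * 1  ≡⟨ inS (p v) m ⟩
      2 * p v + 2 * m            ≤⟨ p-v v (u≢v ∘ sym) ⟩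
      degG G v                   ≡⟨ trans (+-identityʳ (1 * degG G v)) (*-identityˡ (degG G v)) ⟨
      1 * degG G v + 0           ∎
    ...   | yes refl = begin
      2 * (1 * p v) + 2 * m * 1        ≡⟨ inS (p v) m ⟩
      2 * p v + 2 * m                  ≤⟨ +-monoˡ-≤ (2 * m) p-u ⟩
      suc (degG G v) + 2 * m           ≡⟨ +-suc (degG G v) (2 * m) ⟨
      degG G v + suc (2 * m)           ≡⟨ cong₂ _+_ (*-identityˡ (degG G v)) (*-identityˡ (suc (2 * m))) ⟨
      1 * degG G v + 1 * suc (2 * m)   ∎

  -- Here `S` is empty and there is only one block.
  improper : ∀ r → (∀ y → rest r y ≡ true) → demand + m * fixes g ≤ count usable + m
  improper r all-rest = begin
    demand + m * fixes g
      ≤⟨ +-mono-≤ (sum-zero no-demand) (*-monoʳ-≤ m one-block) ⟩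
    m * 1              ≡⟨ *-identityʳ m ⟩
    m                  ≤⟨ m≤n+m m (count usable) ⟩
    count usable + m   ∎
    where
    open ≤-Reasoning
    no-demand : ∀ v → 𝟙 (S v) * p v ≤ 0
    no-demand v with S v | proj₂ (∧-true ⌊ g v ≟ r ⌋ (all-rest v))
    ... | false | _ = z≤n
    g≡r : ∀ v → g v ≡ r
    g≡r v = ⌊⌋⁻ (g v ≟ r) (proj₁ (∧-true ⌊ g v ≟ r ⌋ (all-rest v)))
    one-block : fixes g ≤ 1
    one-block = count-injective {Q = λ (_ : Fin 1) → true} (λ _ → zero) (λ _ _ → refl)
      λ x y gx gy _ → trans (sym (⌊⌋⁻ (g x ≟ x) gx)) (trans (trans (g≡r x) (sym (g≡r y))) (⌊⌋⁻ (g y ≟ y) gy))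

  -- Parity absorbs the extra 1 that rounding up at `u` costs.
  2*-cancel-≤1+ : ∀ x y → 2 * x ≤ suc (2 * y) → x ≤ y
  2*-cancel-≤1+ x y 2x≤ with x ≤? y
  ... | yes x≤y = x≤y
  ... | no  x≰y = ⊥-elim (<⇒≱ (≤-trans (≤-reflexive (two-suc y)) (*-monoʳ-≤ 2 (≰⇒> x≰y))) 2x≤)
    where
    two-suc : ∀ y → suc (suc (2 * y)) ≡ 2 * suc y
    two-suc = solve-∀

  -- Adding `demand-bound` and `degree-bound` gives twice the claim with an excess of 1. A rest
  -- equal to the whole vertex set is treated apart, since it has no proper cut.
  partition-bound : demand + m * fixes g ≤ count usable + m
  partition-bound with any? (λ r → all? λ y → rest r y Bool.≟ true)
  ... | yes (r , all-rest) = improper r all-rest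
  ... | no ¬r = 2*-cancel-≤1+ _ _ (+-cancelʳ-≤ (2 * m * count S + degreeSum) _ _ (begin
    2 * (demand + m * fixes g) + (2 * m * count S + degreeSum)
      ≡⟨ regroup demand m (fixes g) (count S) degreeSum ⟩
    (2 * demand + 2 * m * count S) + (degreeSum + 2 * m * fixes g)
      ≤⟨ +-mono-≤ demand-bound (degree-bound proper) ⟩
    (degreeSum + suc (2 * m)) + (2 * count usable + 2 * m * count S)
      ≡⟨ regroup′ degreeSum m (count usable) (count S) ⟩
    suc (2 * (count usable + m)) + (2 * m * count S + degreeSum) ∎))
    where
    open ≤-Reasoning
    proper : ∀ r → ∃ λ y → rest r y ≡ false
    proper r with any? (λ y → rest r y Bool.≟ false)
    ... | yes found = found
    ... | no ¬y = ⊥-elim (¬r (r , λ y → ¬-not λ ry → ¬y (y , ry)))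
    regroup : ∀ q m f c d → 2 * (q + m * f) + (2 * m * c + d) ≡ (2 * q + 2 * m * c) + (d + 2 * m * f)
    regroup = solve-∀
    regroup′ : ∀ d m r c → (d + suc (2 * m)) + (2 * r + 2 * m * c) ≡ suc (2 * (r + m)) + (2 * m * c + d)
    regroup′ = solve-∀

-- Sums over grids, and representatives of equivalence classes

sum-split : ∀ a {b} (f : Fin (a + b) → ℕ) → sum f ≡ sum (λ i → f (i ↑ˡ b)) + sum (λ j → f (a ↑ʳ j))
sum-split zero    f = refl
sum-split (suc a) f = trans (cong (f zero +_) (sum-split a (f ∘ suc))) (sym (+-assoc (f zero) _ _))

sum-combine : ∀ a {b} (f : Fin (a * b) → ℕ) → sum f ≡ sum (λ (i : Fin a) → sum (λ (j : Fin b) → f (combine i j)))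
sum-combine zero        f = refl
sum-combine (suc a) {b} f = trans (sum-split b f)
  (cong (sum (λ j → f (j ↑ˡ (a * b))) +_) (sum-combine a (λ x → f (b ↑ʳ x))))

count-combine : ∀ a {b} (P : Fin (a * b) → Bool) →
  count P ≡ sum (λ (i : Fin a) → count (λ (j : Fin b) → P (combine i j)))
count-combine a P = trans (count≡sum P) (trans (sum-combine a (𝟙 ∘ P))
  (sum-cong-≗ λ (i : Fin a) → sym (count≡sum (λ j → P (combine i j)))))

sum-const≥ : ∀ {f : Fin a → ℕ} {c} → (∀ i → suc (f i) ≤ c) → sum f + a ≤ a * c
sum-const≥ {zero} _ = z≤n
sum-const≥ {suc a} {f} {c} f<c = begin
  f zero + sum (f ∘ suc) + suc a     ≡⟨ regroup (f zero) (sum (f ∘ suc)) a ⟩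
  suc (f zero) + (sum (f ∘ suc) + a) ≤⟨ +-mono-≤ (f<c zero) (sum-const≥ (f<c ∘ suc)) ⟩
  c + a * c                          ∎
  where
  open ≤-Reasoning
  regroup : ∀ x y z → x + y + suc z ≡ suc x + (y + z)
  regroup = solve-∀

count-< : ∀ {b} q → count {b} (λ j → ⌊ toℕ j <? q ⌋) ≤ q
count-< {zero}  q       = z≤n
count-< {suc b} zero    = ≤-reflexive
  (count-none {P = λ (j : Fin (suc b)) → ⌊ toℕ j <? 0 ⌋} λ j → ⌊⌋⁺ᶠ (toℕ j <? 0) λ ())
count-< {suc b} (suc q) = s≤s (≤-trans
  (count-mono λ (j : Fin b) p → ⌊⌋⁺ (toℕ j <? q) (≤-pred (⌊⌋⁻ (suc (toℕ j) <? suc q) p))) (count-< {b} q))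

-- The index `d` ends the search and is the default; it is meant to satisfy `P`, and then the result
-- does not depend on it.
first : (P : Fin a → Bool) → Fin a → Fin a
first {suc a} P d with P zero
first {suc a} P d       | true  = zero
first {suc a} P zero    | false = zero
first {suc a} P (suc d) | false = suc (first (P ∘ suc) d)

first-sat : (P : Fin a → Bool) (d : Fin a) → P d ≡ true → P (first P d) ≡ true
first-sat {suc a} P d Pd with P zero in P₀
first-sat {suc a} P d       Pd | true  = P₀
first-sat {suc a} P zero    Pd | false = Pd
first-sat {suc a} P (suc d) Pd | false = first-sat (P ∘ suc) d Pd

first-cong : (P Q : Fin a → Bool) (c d : Fin a) → P ≗ Q → P c ≡ true → Q d ≡ true → first P c ≡ first Q d
first-cong {suc a} P Q c d P≗Q Pc Qd with P zero in P₀ | Q zero in Q₀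
... | true  | true  = refl
... | true  | false = ⊥-elim (true≢false P₀ (trans (P≗Q zero) Q₀))
... | false | true  = ⊥-elim (true≢false Q₀ (trans (sym (P≗Q zero)) P₀))
first-cong {suc a} P Q zero    d       P≗Q Pc Qd | false | false = ⊥-elim (true≢false Pc P₀)
first-cong {suc a} P Q (suc c) zero    P≗Q Pc Qd | false | false = ⊥-elim (true≢false Qd Q₀)
first-cong {suc a} P Q (suc c) (suc d) P≗Q Pc Qd | false | false =
  cong suc (first-cong (P ∘ suc) (Q ∘ suc) c d (P≗Q ∘ suc) Pc Qd)

-- Labeling each element by the least member of its class turns a decidable equivalence into an
-- idempotent labeling.
module Representatives (_≈_ : Fin a → Fin a → Set) (_≈?_ : ∀ x y → Dec (x ≈ y))
  (≈-refl : ∀ x → x ≈ x) (≈-sym : ∀ {x y} → x ≈ y → y ≈ x) (≈-trans : ∀ {x y z} → x ≈ y → y ≈ z → x ≈ z) where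

  rep : Fin a → Fin a
  rep x = first (λ y → ⌊ y ≈? x ⌋) x

  rep-≈ : ∀ x → rep x ≈ x
  rep-≈ x = ⌊⌋⁻ (rep x ≈? x) (first-sat (λ y → ⌊ y ≈? x ⌋) x (⌊⌋⁺ (x ≈? x) (≈-refl x)))

  rep-cong : ∀ {x y} → x ≈ y → rep x ≡ rep y
  rep-cong {x} {y} x≈y = first-cong _ _ x y same (⌊⌋⁺ (x ≈? x) (≈-refl x)) (⌊⌋⁺ (y ≈? y) (≈-refl y))
    where
    same : ∀ z → ⌊ z ≈? x ⌋ ≡ ⌊ z ≈? y ⌋
    same z with z ≈? x
    ... | yes z≈x = sym (⌊⌋⁺ (z ≈? y) (≈-trans z≈x x≈y))
    ... | no  z≉x = sym (⌊⌋⁺ᶠ (z ≈? y) (λ z≈y → z≉x (≈-trans z≈y (≈-sym x≈y))))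

  rep-⁻ : ∀ {x y} → rep x ≡ rep y → x ≈ y
  rep-⁻ {x} {y} eq = ≈-trans (≈-sym (rep-≈ x)) (subst (_≈ y) (sym eq) (rep-≈ y))

  rep-idem : Idem rep
  rep-idem x = rep-cong (rep-≈ x)

-- The gadget of glued copies and pendant slots

-- The vertices form a grid of m rows of copies and K rows of slots. The gluing at u and the removal
-- of the slots j ≥ p v are both encoded in the initial labeling ℓ₀, which sends them to the root;
-- the slot realizations of the edges of M are loops.
module Gadget (G : Graph) (m : ℕ) (i₀ : Fin m) (M : EdgeSet G) (u : Fin (n G))
  (p : Fin (n G) → ℕ) (K : ℕ) where

  open Cuts G

  N : ℕ
  N = (m + K) * n G

  copy : Fin m → Fin (n G) → Fin N
  copy i v = combine (i ↑ˡ K) v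

  slot : Fin K → Fin (n G) → Fin N
  slot j v = combine (m ↑ʳ j) v

  root : Fin N
  root = copy i₀ u

  by-kind : (Fin m → Fin (n G) → A) → (Fin K → Fin (n G) → A) → Fin m ⊎ Fin K → Fin (n G) → A
  by-kind f g (inj₁ i) v = f i v
  by-kind f g (inj₂ j) v = g j v

  elim : (Fin m → Fin (n G) → A) → (Fin K → Fin (n G) → A) → Fin N → A
  elim f g = (λ (y , v) → by-kind f g (splitAt m y) v) ∘ remQuot {m + K} (n G)

  module _ (f : Fin m → Fin (n G) → A) (g : Fin K → Fin (n G) → A) where

    elim-copy : ∀ i v → elim f g (copy i v) ≡ f i v
    elim-copy i v = trans (cong (λ (y , w) → by-kind f g (splitAt m y) w) (remQuot-combine {m + K} (i ↑ˡ K) v))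
      (cong (λ y → by-kind f g y v) (splitAt-↑ˡ m i K))

    elim-slot : ∀ j v → elim f g (slot j v) ≡ g j v
    elim-slot j v = trans (cong (λ (y , w) → by-kind f g (splitAt m y) w) (remQuot-combine {m + K} (m ↑ʳ j) v))
      (cong (λ y → by-kind f g y v) (splitAt-↑ʳ m K j))

  view : (P : Fin N → Set) → (∀ i v → P (copy i v)) → (∀ j v → P (slot j v)) → ∀ x → P x
  view P copies slots x = subst P (combine-remQuot {m + K} (n G) x)
    (go (proj₁ (remQuot {m + K} (n G) x)) (proj₂ (remQuot {m + K} (n G) x)))
    where
    go : ∀ y v → P (combine y v)
    go y v with splitAt m y in eq
    ... | inj₁ i = subst (λ z → P (combine z v)) (splitAt⁻¹-↑ˡ eq) (copies i v)
    ... | inj₂ j = subst (λ z → P (combine z v)) (splitAt⁻¹-↑ʳ {m} {K} {y} eq) (slots j v)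

  ℓ₀ : Fin N → Fin N
  ℓ₀ = elim (λ i v → if ⌊ v ≟ u ⌋ then root else copy i v)
            (λ j v → if ⌊ toℕ j <? p v ⌋ then slot j v else root)

  ℓ₀-copy : ∀ i v → ℓ₀ (copy i v) ≡ (if ⌊ v ≟ u ⌋ then root else copy i v)
  ℓ₀-copy = elim-copy _ _

  ℓ₀-slot : ∀ j v → ℓ₀ (slot j v) ≡ (if ⌊ toℕ j <? p v ⌋ then slot j v else root)
  ℓ₀-slot = elim-slot _ _

  ℓ₀-copy-u : ∀ i → ℓ₀ (copy i u) ≡ root
  ℓ₀-copy-u i = trans (ℓ₀-copy i u) (cong (λ b → if b then root else copy i u) (⌊⌋⁺ (u ≟ u) refl))

  ℓ₀-root : ℓ₀ root ≡ root
  ℓ₀-root = ℓ₀-copy-u i₀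

  ℓ₀-cases : ∀ x → ℓ₀ x ≡ x ⊎ ℓ₀ x ≡ root
  ℓ₀-cases = view (λ x → ℓ₀ x ≡ x ⊎ ℓ₀ x ≡ root) copies slots
    where
    copies : ∀ i v → ℓ₀ (copy i v) ≡ copy i v ⊎ ℓ₀ (copy i v) ≡ root
    copies i v with v ≟ u | ℓ₀-copy i v
    ... | yes _ | eq = inj₂ eq
    ... | no _  | eq = inj₁ eq
    slots : ∀ j v → ℓ₀ (slot j v) ≡ slot j v ⊎ ℓ₀ (slot j v) ≡ root
    slots j v with ⌊ toℕ j <? p v ⌋ | ℓ₀-slot j v
    ... | true  | eq = inj₁ eq
    ... | false | eq = inj₂ eq

  ℓ₀-idem : Idem ℓ₀
  ℓ₀-idem x with ℓ₀-cases x
  ... | inj₁ eq = cong ℓ₀ eq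
  ... | inj₂ eq = trans (cong ℓ₀ eq) (trans ℓ₀-root (sym eq))

  -- `inj₁ i` places an edge in copy `i`; `inj₂ (j , β)` attaches it to slot `j` of its source or
  -- target, chosen by `β`, which becomes its tail.
  C : Set
  C = Fin m ⊎ Fin K × Bool

  anyC? : {P : C → Set} → Decidable P → Dec (∃ P)
  anyC? {P} P? = map′ to from (any? (P? ∘ inj₁) ⊎-dec any? λ j → P? (inj₂ (j , true)) ⊎-dec P? (inj₂ (j , false)))
    where
    to : (∃ λ i → P (inj₁ i)) ⊎ (∃ λ j → P (inj₂ (j , true)) ⊎ P (inj₂ (j , false))) → ∃ P
    to (inj₁ (i , q))      = inj₁ i , q
    to (inj₂ (j , inj₁ q)) = inj₂ (j , true) , q
    to (inj₂ (j , inj₂ q)) = inj₂ (j , false) , q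
    from : ∃ P → (∃ λ i → P (inj₁ i)) ⊎ (∃ λ j → P (inj₂ (j , true)) ⊎ P (inj₂ (j , false)))
    from (inj₁ i , q)           = inj₁ (i , q)
    from (inj₂ (j , true) , q)  = inj₂ (j , inj₁ q)
    from (inj₂ (j , false) , q) = inj₂ (j , inj₂ q)

  end : Fin (k G) → Bool → Fin (n G)
  end e β = if β then src e else tgt e

  real : Fin (k G) → C → Fin N × Fin N
  real e (inj₁ i)       = copy i (src e) , copy i (tgt e)
  real e (inj₂ (j , β)) = root , (if M e then root else slot j (end e β))

  open Rainbow ℓ₀ ℓ₀-idem C anyC? real public

  count-N : (P : Fin N → Bool) →
    count P ≡ sum (λ i → count (λ v → P (copy i v))) + sum (λ j → count (λ v → P (slot j v)))
  count-N P = trans (count-combine (m + K) P) (sum-split m (λ y → count (λ v → P (combine y v))))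

  -- Rado's condition for the gadget

  module Partition (conn : EdgeConnected (2 * m) G) (M≤m : MaxDegLe G M m)
    (p-u : 2 * p u ≤ suc (degG G u)) (p-v : ∀ v → v ≢ u → 2 * p v + 2 * m ≤ degG G v)
    (f : Fin N → Fin N) (f-idem : Idem f) (ℓ₀⊑f : ℓ₀ ⊑ f) where

    infix 4 _≈_ _≈?_
    -- Its classes are the blocks of the common refinement of the partitions that `f` induces on the
    -- copies.
    _≈_ : Fin (n G) → Fin (n G) → Set
    v ≈ w = ∀ i → f (copy i v) ≡ f (copy i w)

    _≈?_ : ∀ v w → Dec (v ≈ w)
    v ≈? w = all? λ i → f (copy i v) ≟ f (copy i w)

    open Representatives _≈_ _≈?_ (λ _ _ → refl) (λ eq i → sym (eq i)) (λ eq eq′ i → trans (eq i) (eq′ i))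

    Detached : Fin (n G) → Fin K → Set
    Detached v j = toℕ j < p v × f (slot j v) ≢ f root

    detached? : ∀ v → Decidable (Detached v)
    detached? v j = (toℕ j <? p v) ×-dec ¬? (f (slot j v) ≟ f root)

    S : Fin (n G) → Bool
    S v = ⌊ any? (detached? v) ⌋

    open PartitionBound G m conn M M≤m u p p-u p-v rep rep-idem S

    f-copy-u : ∀ i → f (copy i u) ≡ f root
    f-copy-u i = ℓ₀⊑f (trans (ℓ₀-copy-u i) (sym ℓ₀-root))

    f-slot-unused : ∀ j v → ¬ toℕ j < p v → f (slot j v) ≡ f root
    f-slot-unused j v j≮p = ℓ₀⊑f (trans (ℓ₀-slot j v)
      (trans (cong (λ b → if b then slot j v else root) (⌊⌋⁺ᶠ (toℕ j <? p v) j≮p)) (sym ℓ₀-root)))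

    other : Fin N → Bool
    other = fixed f ∖ f root

    other⁻ : ∀ x → other x ≡ true → f x ≡ x × x ≢ f root
    other⁻ x ox = let fx , x≢ = ∖-⁻ (fixed f) (f root) x ox in ⌊⌋⁻ (f x ≟ x) fx , x≢

    -- The representatives in copy `i` of classes other than that of the root, together with `u`,
    -- lie in distinct classes of `f` within this copy, so they are pairwise inequivalent.
    copy-bound : ∀ i → suc (count (λ v → other (copy i v))) ≤ fixes rep
    copy-bound i = ≤-trans
      (≤-reflexive (sym (count-insert {P = λ v → other (copy i v)} {Q} u
        u∉ (∨-trueʳ (other (copy i u)) (⌊⌋⁺ (u ≟ u) refl)) same)))
      (count-injective rep (λ v _ → ⌊⌋⁺ (rep (rep v) ≟ rep v) (rep-idem v)) inj)
      where
      Q : Fin (n G) → Bool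
      Q v = other (copy i v) ∨ ⌊ v ≟ u ⌋
      not-root : ∀ v → other (copy i v) ≡ true → f (copy i v) ≢ f root
      not-root v ov eq = let fx , x≢ = other⁻ (copy i v) ov in x≢ (trans (sym fx) eq)
      u∉ : other (copy i u) ≡ false
      u∉ = ¬-not λ ou → not-root u ou (f-copy-u i)
      same : ∀ v → v ≢ u → other (copy i v) ≡ Q v
      same v v≢u rewrite ⌊⌋⁺ᶠ (v ≟ u) v≢u = sym (∨-identityʳ _)
      Q⁻ : ∀ v → Q v ≡ true → other (copy i v) ≡ true ⊎ v ≡ u
      Q⁻ v Qv with ∨-true (other (copy i v)) Qv
      ... | inj₁ ov = inj₁ ov
      ... | inj₂ eq = inj₂ (⌊⌋⁻ (v ≟ u) eq)
      inj : ∀ v w → Q v ≡ true → Q w ≡ true → rep v ≡ rep w → v ≡ w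
      inj v w Qv Qw eq with rep-⁻ eq i | Q⁻ v Qv | Q⁻ w Qw
      ... | v≈w | inj₁ ov | inj₁ ow = combine-injectiveʳ (i ↑ˡ K) v (i ↑ˡ K) w
              (trans (sym (proj₁ (other⁻ _ ov))) (trans v≈w (proj₁ (other⁻ _ ow))))
      ... | v≈w | inj₁ ov | inj₂ refl = ⊥-elim (not-root v ov (trans v≈w (f-copy-u i)))
      ... | v≈w | inj₂ refl | inj₁ ow = ⊥-elim (not-root w ow (trans (sym v≈w) (f-copy-u i)))
      ... | v≈w | inj₂ refl | inj₂ refl = refl

    -- A slot of `v` that represents another class is one of the `p v` slots in use, and it puts `v`
    -- into `S`.
    slot-bound : sum (λ j → count (λ v → other (slot j v))) ≤ demand
    slot-bound = begin
      sum (λ j → count (λ v → other (slot j v)))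
        ≡⟨ sum-cong-≗ (λ j → count≡sum (λ v → other (slot j v))) ⟩
      sum (λ j → sum (λ v → 𝟙 (other (slot j v))))
        ≤⟨ sum-mono (λ (j : Fin K) → sum-mono (charge j)) ⟩
      sum (λ (j : Fin K) → sum (λ v → 𝟙 (S v) * 𝟙 ⌊ toℕ j <? p v ⌋))
        ≡⟨ ∑-comm (λ (j : Fin K) v → 𝟙 (S v) * 𝟙 ⌊ toℕ j <? p v ⌋) ⟩
      sum (λ v → sum (λ (j : Fin K) → 𝟙 (S v) * 𝟙 ⌊ toℕ j <? p v ⌋))
        ≡⟨ sum-cong-≗ (λ v → *-distribˡ-sum (𝟙 (S v)) (λ (j : Fin K) → 𝟙 ⌊ toℕ j <? p v ⌋)) ⟨
      sum (λ v → 𝟙 (S v) * sum (λ (j : Fin K) → 𝟙 ⌊ toℕ j <? p v ⌋))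
        ≤⟨ sum-mono (λ v → *-monoʳ-≤ (𝟙 (S v)) (≤-trans
             (≤-reflexive (sym (count≡sum (λ (j : Fin K) → ⌊ toℕ j <? p v ⌋)))) (count-< {K} (p v)))) ⟩
      demand ∎
      where
      open ≤-Reasoning
      charge : ∀ j v → 𝟙 (other (slot j v)) ≤ 𝟙 (S v) * 𝟙 ⌊ toℕ j <? p v ⌋
      charge j v with other (slot j v) in oj
      ... | false = z≤n
      ... | true with toℕ j <? p v
      ...   | no j≮p = let fx , x≢ = other⁻ (slot j v) oj in ⊥-elim (x≢ (trans (sym fx) (f-slot-unused j v j≮p)))
      ...   | yes j<p = ≤-reflexive (cong (λ b → 𝟙 b * 1) (sym (⌊⌋⁺ (any? (detached? v)) (j , j<p , λ eq →
                let fx , x≢ = other⁻ (slot j v) oj in x≢ (trans (sym fx) eq)))))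

    -- If no realization of `e` crosses, its ends agree in every copy and hence are equivalent. If
    -- moreover `e` is not in `M`, all slots of its ends belong to the class of the root, so neither
    -- end is in `S`.
    usable⊆crosses : ∀ e → usable e ≡ true → ⌊ crosses? f e ⌋ ≡ true
    usable⊆crosses e use with crosses? f e
    ... | yes _ = refl
    ... | no ¬cross = ⊥-elim (contra (∨-true (crossing e) use))
      where
      joined : ∀ q → Joined f (real e q)
      joined q = decidable-stable (joined? f (real e q)) λ ¬j → ¬cross (q , ¬j)
      attached : ∀ β → M e ≡ false → S (end e β) ≡ true → ⊥
      attached β Me Sβ with j , j<p , ≢root ← ⌊⌋⁻ (any? (detached? (end e β))) Sβ =
        ≢root (sym (trans (joined (inj₂ (j , β))) (cong (λ b → f (if b then root else slot j (end e β))) Me)))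
      not-true : ∀ {b} → not b ≡ true → b ≡ false
      not-true {false} _ = refl
      contra : crossing e ≡ true ⊎ not (M e) ∧ touching e ≡ true → ⊥
      contra (inj₁ cr) = ⌊⌋⁻ᶠ (rep (src e) ≟ rep (tgt e)) (not-true cr) (rep-cong λ i → joined (inj₁ i))
      contra (inj₂ Mt) with Me , touch ← ∧-true (not (M e)) Mt with ∨-true (S (src e)) touch
      ... | inj₁ Ss = attached true (not-true Me) Ss
      ... | inj₂ St = attached false (not-true Me) St

    few-classes : fixes f ≤ suc (count (λ e → ⌊ crosses? f e ⌋))
    few-classes = ≤-trans (≤-reflexive (count-∖ (fixed f) (f root) (⌊⌋⁺ (f (f root) ≟ f root) (f-idem root))))
      -- The added `m` pays for the vertex `u`, which `copy-bound` counts once in each copy.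
      (s≤s (+-cancelʳ-≤ m _ _ (begin
        count other + m
          ≡⟨ cong (_+ m) (count-N other) ⟩
        copies + slots + m
          ≡⟨ regroup copies slots m ⟩
        slots + (copies + m)
          ≤⟨ +-mono-≤ slot-bound (sum-const≥ copy-bound) ⟩
        demand + m * fixes rep
          ≤⟨ partition-bound ⟩
        count usable + m
          ≤⟨ +-monoˡ-≤ m (count-mono usable⊆crosses) ⟩
        count (λ e → ⌊ crosses? f e ⌋) + m ∎)))
      where
      open ≤-Reasoning
      copies slots : ℕ
      copies = sum (λ i → count (λ v → other (copy i v)))
      slots = sum (λ j → count (λ v → other (slot j v)))
      regroup : ∀ x y z → x + y + z ≡ y + (x + z)
      regroup = solve-∀

-- Reachability and spanning trees

module Trees (G : Graph) where

  open Cuts G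

  private
    variable
      X Y : EdgeSet G

  joins-sym : ∀ {e x y} → Joins G e x y → Joins G e y x
  joins-sym (inj₁ eq) = inj₂ eq
  joins-sym (inj₂ eq) = inj₁ eq

  reach-trans : ∀ {x y z} → Reach G X x y → Reach G X y z → Reach G X x z
  reach-trans here           r = r
  reach-trans (step e Xe j q) r = step e Xe j (reach-trans q r)

  reach-sym : ∀ {x y} → Reach G X x y → Reach G X y x
  reach-sym here            = here
  reach-sym (step e Xe j q) = reach-trans (reach-sym q) (step e Xe (joins-sym j) here)

  reach-reroute : (∀ e {x y} → X e ≡ true → Joins G e x y → Reach G Y x y) →
    ∀ {x y} → Reach G X x y → Reach G Y x y
  reach-reroute detour here            = here
  reach-reroute detour (step e Xe j q) = reach-trans (detour e Xe j) (reach-reroute detour q)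

  edges : EdgeSet G → Fin (k G) → Maybe (Fin (n G) × Fin (n G))
  edges X e = if X e then just (ends G e) else nothing

  -- Contracting all edges of `X` labels the connected components, which makes connectedness
  -- decidable.
  component : EdgeSet G → Fin (n G) → Fin (n G)
  component X = lab id (edges X)

  component-reach : ∀ X {x y} → component X x ≡ component X y → Reach G X x y
  component-reach X = lab-least (edges X) (Reach G X) reach-sym reach-trans (λ { refl → here }) edge
    where
    edge : ∀ e {x y} → edges X e ≡ just (x , y) → Reach G X x y
    edge e eq with X e in Xe
    ... | true = step e Xe (inj₁ (just-injective eq)) here

  reach-component : ∀ X {x y} → Reach G X x y → component X x ≡ component X y
  reach-component X = reach-invariant (component X) λ e Xe →
    lab-joins (edges X) e (cong (λ b → if b then just (ends G e) else nothing) Xe)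

  connected? : ∀ X → Dec (Connected G X)
  connected? X = map′ (λ same x y → component-reach X (same x y)) (λ conn x y → reach-component X (conn x y))
    (all? λ x → all? λ y → component X x ≟ component X y)

  Minimal : EdgeSet G → Set
  Minimal X = ∀ e → X e ≡ true → ¬ Connected G (X ∖ e)

  next-step : ∀ {r} (i : Fin (suc r)) → next i ≡ zero ⊎ toℕ (next i) ≡ suc (toℕ i)
  next-step {zero}  zero    = inj₁ refl
  next-step {suc r} zero    = inj₂ refl
  next-step {suc r} (suc i) with next {r} i | next-step {r} i
  ... | zero  | _       = inj₁ refl
  ... | suc j | inj₂ eq = inj₂ (cong suc eq)

  -- An edge of a cycle can be bypassed along the rest of the cycle, so deleting it would keep `X`
  -- connected.
  minimal⇒acyclic : Connected G X → Minimal X → ¬ Cycle G X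
  minimal⇒acyclic {X} conn minimal cyc = minimal e₀ (inA zero) λ x y → reach-reroute detour (conn x y)
    where
    open Cycle cyc
    e₀ = es zero
    walk : ∀ fuel i → i ≢ zero → suc (suc len) ≤ toℕ i + fuel → Reach G (X ∖ e₀) (vs i) (vs zero)
    walk zero i i≢0 bound = ⊥-elim (<⇒≱ (toℕ<n i) (≤-trans bound (≤-reflexive (+-identityʳ _))))
    walk (suc fuel) i i≢0 bound = step (es i) (∖-⁺ X e₀ (es i) (inA i) (i≢0 ∘ esInj)) (joins i) onward
      where
      onward : Reach G (X ∖ e₀) (vs (next i)) (vs zero)
      onward with next i | next-step i
      ... | zero  | _       = here
      ... | suc j | inj₂ eq = walk fuel (suc j) (λ ())
        (≤-trans bound (≤-reflexive (trans (+-suc (toℕ i) fuel) (cong (_+ fuel) (sym eq)))))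
    around : Reach G (X ∖ e₀) (vs (suc zero)) (vs zero)
    around = walk (suc len) (suc zero) (λ ()) ≤-refl
    bypass : ∀ {x y} → Joins G e₀ x y → Reach G (X ∖ e₀) x y
    bypass j with joins zero | j
    ... | inj₁ p | inj₁ q with refl ← trans (sym p) q = reach-sym around
    ... | inj₁ p | inj₂ q with refl ← trans (sym p) q = around
    ... | inj₂ p | inj₁ q with refl ← trans (sym p) q = around
    ... | inj₂ p | inj₂ q with refl ← trans (sym p) q = reach-sym around
    detour : ∀ e {x y} → X e ≡ true → Joins G e x y → Reach G (X ∖ e₀) x y
    detour e Xe j with e ≟ e₀
    ... | yes refl = bypass j
    ... | no  e≢e₀ = step e (∖-⁺ X e₀ e Xe e≢e₀) j here

  -- Edges are deleted as long as the set stays connected; the fuel bounds their number.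
  spanning-tree : ∀ X → Connected G X → ∃ λ T → Sub G T X × SpanningTree G T
  spanning-tree X = go (count X) X ≤-refl
    where
    go : ∀ fuel X → count X ≤ fuel → Connected G X → ∃ λ T → Sub G T X × SpanningTree G T
    go fuel X size≤ conn with any? (λ e → (X e Bool.≟ true) ×-dec connected? (X ∖ e))
    ... | no minimal = X , (λ _ Xe → Xe) , conn , minimal⇒acyclic conn λ e Xe c → minimal (e , Xe , c)
    go zero       X size≤ conn | yes (e , Xe , c) rewrite count-∖ X e Xe with () ← size≤
    go (suc fuel) X size≤ conn | yes (e , Xe , c) =
      let T , T⊆ , tree = go fuel (X ∖ e) (≤-pred (≤-trans (≤-reflexive (sym (count-∖ X e Xe))) size≤)) c
      in T , (λ d Td → proj₁ (∖-⁻ X e d (T⊆ d Td))) , tree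

-- Reading off the decomposition from a connecting choice

module Extraction (G : Graph) (m : ℕ) (i₀ : Fin m) (M : EdgeSet G) (u : Fin (n G))
  (p : Fin (n G) → ℕ) (K : ℕ) (p≤K : ∀ v → p v ≤ K) where

  open Cuts G
  open Trees G
  open Gadget G m i₀ M u p K

  module Result (s : Choice) (connecting : Connecting s) where

    isCopy : Fin m → Maybe C → Bool
    isCopy i (just (inj₁ i′)) = ⌊ i ≟ i′ ⌋
    isCopy i _                = false

    isSlot : Maybe C → Bool
    isSlot (just (inj₂ _)) = true
    isSlot _               = false

    treeEdges : Fin m → EdgeSet G
    treeEdges i e = isCopy i (s e)

    -- Edges without a selected realization, and edges of `M` realized as loops at the root, go to
    -- `h` too. Its complement keeps only edges that lead to slots.
    h : EdgeSet G
    h e = M e ∨ not (isSlot (s e))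

    o : Orientation G
    o e with s e
    ... | just (inj₂ (_ , β)) = β
    -- A default value: these edges lie in `h`.
    ... | _                   = true

    -- Turns connectivity of the gadget into a principle for any equivalence that contains the
    -- initial gluing and the selected edges: such an `E` relates all vertices.
    relate : (E : Fin N → Fin N → Set) → (∀ {x y} → E x y → E y x) → (∀ {x y z} → E x y → E y z → E x z) →
      (∀ {x y} → ℓ₀ x ≡ ℓ₀ y → E x y) →
      (∀ e q → s e ≡ just q → E (proj₁ (real e q)) (proj₂ (real e q))) → ∀ x y → E x y
    relate E E-sym E-trans base edge x y = lab-least (selected s all) E E-sym E-trans base
      (λ e sel → let q , _ , se , eq = selected⁻ s all e sel
                 in subst (λ xy → E (proj₁ xy) (proj₂ xy)) eq (edge e q se))
      (connecting x y)

    module _ (i : Fin m) where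

      -- Collapses the gadget onto copy `i`. Everything else is attached to this copy only at the
      -- glued vertex, so it goes to `u`.
      retract-copy : Fin m → Fin (n G) → Fin (n G)
      retract-copy i′ v = if ⌊ i ≟ i′ ⌋ then v else u

      retract : Fin N → Fin (n G)
      retract = elim retract-copy (λ _ _ → u)

      retract-on-copy : ∀ i′ v → retract (copy i′ v) ≡ retract-copy i′ v
      retract-on-copy = elim-copy retract-copy (λ _ _ → u)

      retract-on-slot : ∀ j v → retract (slot j v) ≡ u
      retract-on-slot = elim-slot retract-copy (λ _ _ → u)

      retract-root : retract root ≡ u
      retract-root = trans (retract-on-copy i₀ u) (if-eta ⌊ i ≟ i₀ ⌋)

      retract-ℓ₀ : ∀ x → retract (ℓ₀ x) ≡ retract x
      retract-ℓ₀ = view (λ x → retract (ℓ₀ x) ≡ retract x) copies slots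
        where
        copies : ∀ i′ v → retract (ℓ₀ (copy i′ v)) ≡ retract (copy i′ v)
        copies i′ v with v ≟ u | ℓ₀-copy i′ v
        ... | no _     | eq = cong retract eq
        ... | yes refl | eq = trans (cong retract eq) (trans retract-root
          (sym (trans (retract-on-copy i′ v) (if-eta ⌊ i ≟ i′ ⌋))))
        slots : ∀ j v → retract (ℓ₀ (slot j v)) ≡ retract (slot j v)
        slots j v with ⌊ toℕ j <? p v ⌋ | ℓ₀-slot j v
        ... | true  | eq = cong retract eq
        ... | false | eq = trans (cong retract eq) (trans retract-root (sym (retract-on-slot j v)))

      -- The retraction preserves connectivity: selected edges in copy `i` become edges of
      -- `treeEdges i`, and all other selected edges shrink to the point `u`.
      treeEdges-connected : Connected G (treeEdges i)
      treeEdges-connected v w = subst₂ (Reach G (treeEdges i)) (at-i v) (at-i w)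
        (relate (λ x y → Reach G (treeEdges i) (retract x) (retract y)) reach-sym reach-trans
          (λ {x} {y} eq → reach-≡ (trans (sym (retract-ℓ₀ x)) (trans (cong retract eq) (retract-ℓ₀ y))))
          edge (copy i v) (copy i w))
        where
        at-i : ∀ v → retract (copy i v) ≡ v
        at-i v = trans (retract-on-copy i v) (cong (λ b → if b then v else u) (⌊⌋⁺ (i ≟ i) refl))
        reach-≡ : ∀ {x y} → x ≡ y → Reach G (treeEdges i) x y
        reach-≡ refl = here
        edge : ∀ e q → s e ≡ just q →
          Reach G (treeEdges i) (retract (proj₁ (real e q))) (retract (proj₂ (real e q)))
        edge e (inj₁ i′) se = subst₂ (Reach G (treeEdges i))
          (sym (retract-on-copy i′ (src e))) (sym (retract-on-copy i′ (tgt e))) along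
          where
          along : Reach G (treeEdges i) (retract-copy i′ (src e)) (retract-copy i′ (tgt e))
          along with ⌊ i ≟ i′ ⌋ in i≟i′
          ... | true  = step e (trans (cong (isCopy i) se) i≟i′) (inj₁ refl) here
          ... | false = here
        edge e (inj₂ (j , β)) se = reach-≡ (trans retract-root (sym to-root))
          where
          to-root : retract (if M e then root else slot j (end e β)) ≡ u
          to-root with M e
          ... | true  = retract-root
          ... | false = retract-on-slot j (end e β)

    Fills : Fin (n G) → Fin K → Fin (k G) → Set
    Fills v j e = ∃ λ β → s e ≡ just (inj₂ (j , β)) × M e ≡ false × end e β ≡ v

    fills? : ∀ v j e → Dec (Fills v j e)
    fills? v j e with s e
    ... | nothing        = no λ ()
    ... | just (inj₁ _)  = no λ ()
    ... | just (inj₂ (j′ , β)) = map′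
      (λ { (refl , Me , eq) → β , refl , Me , eq }) (λ { (_ , refl , Me , eq) → refl , Me , eq })
      ((j′ ≟ j) ×-dec (M e Bool.≟ false) ×-dec (end e β ≟ v))

    -- Otherwise the slot would be isolated.
    filled : ∀ v j → toℕ j < p v → ∃ (Fills v j)
    filled v j j<p with any? (fills? v j)
    ... | yes found = found
    ... | no ¬found = ⊥-elim (true≢false (⌊⌋⁺ (t ≟ t) refl) (trans
            (relate (λ x y → is-t x ≡ is-t y) sym trans base edge t root)
            (⌊⌋⁺ᶠ (root ≟ t) root≢t)))
      where
      t : Fin N
      t = slot j v
      is-t : Fin N → Bool
      is-t x = ⌊ x ≟ t ⌋
      kind : Fin N → Bool
      kind = elim (λ _ _ → true) (λ _ _ → false)
      root≢t : root ≢ t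
      root≢t eq = true≢false (elim-copy (λ _ _ → true) (λ _ _ → false) i₀ u)
        (trans (cong kind eq) (elim-slot (λ _ _ → true) (λ _ _ → false) j v))
      copy≢t : ∀ i w → copy i w ≢ t
      copy≢t i w eq = true≢false (elim-copy (λ _ _ → true) (λ _ _ → false) i w)
        (trans (cong kind eq) (elim-slot (λ _ _ → true) (λ _ _ → false) j v))
      ℓ₀-t : ℓ₀ t ≡ t
      ℓ₀-t = trans (ℓ₀-slot j v) (cong (λ b → if b then t else root) (⌊⌋⁺ (toℕ j <? p v) j<p))
      is-t-ℓ₀ : ∀ x → is-t (ℓ₀ x) ≡ is-t x
      is-t-ℓ₀ x with ℓ₀-cases x
      ... | inj₁ eq = cong is-t eq
      ... | inj₂ eq = trans (cong is-t eq) (trans (⌊⌋⁺ᶠ (root ≟ t) root≢t)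
              (sym (⌊⌋⁺ᶠ (x ≟ t) λ { refl → root≢t (trans (sym eq) ℓ₀-t) })))
      base : ∀ {x y} → ℓ₀ x ≡ ℓ₀ y → is-t x ≡ is-t y
      base {x} {y} eq = trans (sym (is-t-ℓ₀ x)) (trans (cong is-t eq) (is-t-ℓ₀ y))
      edge : ∀ e q → s e ≡ just q → is-t (proj₁ (real e q)) ≡ is-t (proj₂ (real e q))
      edge e (inj₁ i) se = trans (⌊⌋⁺ᶠ (_ ≟ t) (copy≢t i (src e))) (sym (⌊⌋⁺ᶠ (_ ≟ t) (copy≢t i (tgt e))))
      edge e (inj₂ (j′ , β)) se with M e in Me
      ... | true  = refl
      ... | false = trans (⌊⌋⁺ᶠ (root ≟ t) root≢t) (sym (⌊⌋⁺ᶠ (_ ≟ t) not-t))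
        where
        not-t : slot j′ (end e β) ≢ t
        not-t eq = let rows , ends = combine-injective (m ↑ʳ j′) (end e β) (m ↑ʳ j) v eq in
          ¬found (e , β , trans se (cong (λ i → just (inj₂ (i , β))) (↑ʳ-injective m j′ j rows)) , Me , ends)

    -- Each slot of `v` in use is filled by an edge with tail `v`, and distinct slots need distinct
    -- edges because a color has only one selected realization.
    outdeg-bound : ∀ v → p v ≤ outdeg G (λ e → not (h e)) o v
    outdeg-bound v = ≤-trans (≤-reflexive (sym (count-all (p v))))
      (count-injective {P = λ (_ : Fin (p v)) → true} φ (λ i _ → counted i) λ i j _ _ eq → inj i j eq)
      where
      count-all : ∀ b → count {b} (λ _ → true) ≡ b
      count-all zero    = refl
      count-all (suc b) = cong suc (count-all b)
      index : Fin (p v) → Fin K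
      index i = inject≤ i (p≤K v)
      filler : ∀ i → ∃ (Fills v (index i))
      filler i = filled v (index i) (subst (_< p v) (sym (toℕ-inject≤ i (p≤K v))) (toℕ<n i))
      φ : Fin (p v) → Fin (k G)
      φ i = proj₁ (filler i)
      counted : ∀ i → not (h (φ i)) ∧ ⌊ tail G o (φ i) ≟ v ⌋ ≡ true
      counted i with e , β , se , Me , end≡v ← filler i rewrite Me | se = ⌊⌋⁺ (end e β ≟ v) end≡v
      inj : ∀ i j → φ i ≡ φ j → i ≡ j
      inj i j eq with filler i | filler j
      inj i j refl | e , _ , se , _ | .e , _ , se′ , _ with trans (sym se) se′
      ... | same = inject≤-injective (p≤K v) (p≤K v) i j (slot-index same)
        where
        slot-index : ∀ {x y : Fin K} {β β′ : Bool} → just {A = C} (inj₂ (x , β)) ≡ just (inj₂ (y , β′)) → x ≡ y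
        slot-index refl = refl

    M⊆h : Sub G M h
    M⊆h e Me rewrite Me = refl

    -- The trees are disjoint because the selected realization of an edge lies in at most one copy.
    tree-connected : TreeConnected G m h
    tree-connected = (λ i → proj₁ (tree i)) , (λ i e Te → in-h i e (proj₁ (proj₂ (tree i)) e Te)) ,
      (λ i → proj₂ (proj₂ (tree i))) , disjoint
      where
      tree : ∀ i → ∃ λ T → Sub G T (treeEdges i) × SpanningTree G T
      tree i = spanning-tree (treeEdges i) (treeEdges-connected i)
      in-h : ∀ i → Sub G (treeEdges i) h
      in-h i e Te = ∨-trueʳ (M e) (not-slot (s e) Te)
        where
        not-slot : ∀ x → isCopy i x ≡ true → not (isSlot x) ≡ true
        not-slot (just (inj₁ _)) _ = refl
      disjoint : ∀ i j e → i ≢ j → proj₁ (tree i) e ≡ true → proj₁ (tree j) e ≡ false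
      disjoint i j e i≢j Ti = ¬-not λ Tj → i≢j
        (same (s e) (proj₁ (proj₂ (tree i)) e Ti) (proj₁ (proj₂ (tree j)) e Tj))
        where
        same : ∀ x → isCopy i x ≡ true → isCopy j x ≡ true → i ≡ j
        same (just (inj₁ i′)) p q = trans (⌊⌋⁻ (i ≟ i′) p) (sym (⌊⌋⁻ (j ≟ i′) q))

-- Choice of the slot numbers and conclusion

decomposition : ∀ m → 1 ≤ m → (G : Graph) → EdgeConnected (2 * m) G → (M : EdgeSet G) → MaxDegLe G M m →
  (u : Fin (n G)) → Σ (EdgeSet G) λ h → Σ (Orientation G) λ o →
    GoodDecomp G m M h o × ⌈ degG G u /2⌉ ≤ outdeg G (λ e → not (h e)) o u
decomposition m@(suc _) 1≤m G conn M M≤m u = h , o ,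
  (tree-connected , M⊆h , λ v → ≤-trans (p-≥ v) (outdeg-bound v)) ,
  ≤-trans (≤-reflexive (sym p-at-u)) (outdeg-bound u)
  where
  p : Fin (n G) → ℕ
  p v = if ⌊ v ≟ u ⌋ then ⌈ degG G v /2⌉ else ⌊ degG G v /2⌋ ∸ m
  p-at-u : p u ≡ ⌈ degG G u /2⌉
  p-at-u rewrite ⌊⌋⁺ (u ≟ u) refl = refl
  p-≥ : ∀ v → ⌊ degG G v /2⌋ ∸ m ≤ p v
  p-≥ v with ⌊ v ≟ u ⌋
  ... | true  = ≤-trans (m∸n≤m _ m) (⌊n/2⌋≤⌈n/2⌉ _)
  ... | false = ≤-refl
  p≤k : ∀ v → p v ≤ k G
  p≤k v with ⌊ v ≟ u ⌋
  ... | true  = ≤-trans (⌈n/2⌉≤n _) (count≤ _)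
  ... | false = ≤-trans (m∸n≤m _ m) (≤-trans (⌊n/2⌋≤n _) (count≤ _))
  2⌈/2⌉ : ∀ d → 2 * ⌈ d /2⌉ ≤ suc d
  2⌈/2⌉ d = begin
    ⌈ d /2⌉ + (⌈ d /2⌉ + 0)   ≡⟨ cong (⌈ d /2⌉ +_) (+-identityʳ _) ⟩
    ⌈ d /2⌉ + ⌈ d /2⌉         ≤⟨ +-monoˡ-≤ ⌈ d /2⌉ (⌊n/2⌋-mono (n≤1+n (suc d))) ⟩
    suc (⌊ d /2⌋ + ⌈ d /2⌉)   ≡⟨ cong suc (⌊n/2⌋+⌈n/2⌉≡n d) ⟩
    suc d                     ∎
    where open ≤-Reasoning
  -- For `2 * m ≤ d`, which edge-connectivity ensures for degrees, the truncated subtraction is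
  -- exact.
  2⌊/2⌋∸ : ∀ d → 2 * m ≤ d → 2 * (⌊ d /2⌋ ∸ m) + 2 * m ≤ d
  2⌊/2⌋∸ d 2m≤d = begin
    2 * (⌊ d /2⌋ ∸ m) + 2 * m   ≡⟨ *-distribˡ-+ 2 (⌊ d /2⌋ ∸ m) m ⟨
    2 * (⌊ d /2⌋ ∸ m + m)       ≡⟨ cong (2 *_) (m∸n+n≡m m≤) ⟩
    2 * ⌊ d /2⌋                 ≡⟨ cong (⌊ d /2⌋ +_) (+-identityʳ _) ⟩
    ⌊ d /2⌋ + ⌊ d /2⌋           ≤⟨ +-monoʳ-≤ ⌊ d /2⌋ (⌊n/2⌋≤⌈n/2⌉ d) ⟩
    ⌊ d /2⌋ + ⌈ d /2⌉           ≡⟨ ⌊n/2⌋+⌈n/2⌉≡n d ⟩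
    d                           ∎
    where
    open ≤-Reasoning
    m≤ : m ≤ ⌊ d /2⌋
    m≤ = ≤-trans
      (≤-reflexive (trans (n≡⌊n+n/2⌋ m) (cong (λ x → ⌊ m + x /2⌋) (sym (+-identityʳ m))))) (⌊n/2⌋-mono 2m≤d)
  p-u : 2 * p u ≤ suc (degG G u)
  p-u = ≤-trans (≤-reflexive (cong (2 *_) p-at-u)) (2⌈/2⌉ (degG G u))
  p-v : ∀ v → v ≢ u → 2 * p v + 2 * m ≤ degG G v
  p-v v v≢u rewrite ⌊⌋⁺ᶠ (v ≟ u) v≢u = 2⌊/2⌋∸ (degG G v) (Cuts.deg≥ G conn u v v≢u)
  -- Since `m` is positive, copy `zero` exists and can carry the root. A supply of `k G` slots per
  -- vertex suffices by `p≤k`.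
  open Gadget G m zero M u p (k G)
  open Theorem (Partition.few-classes conn M≤m p-u p-v) using (rainbow)
  open Extraction G m zero M u p (k G) p≤k
  open Result (proj₁ rainbow) (proj₂ rainbow)

theorem5p8 : (m : ℕ) → 1 ≤ m → (G : Graph) → EdgeConnected (2 * m) G →
    (M : EdgeSet G) → MaxDegLe G M m →
    (Σ (EdgeSet G) λ h → Σ (Orientation G) λ o → GoodDecomp G m M h o)
    × ((u : Fin (n G)) → Σ (EdgeSet G) λ h → Σ (Orientation G) λ o →
    GoodDecomp G m M h o × ⌈ degG G u /2⌉ ≤ outdeg G (λ e → not (h e)) o u)
theorem5p8 m 1≤m G conn M M≤m = somewhere (n G) refl , decomposition m 1≤m G conn M M≤m
  where
  -- Any vertex can serve as `u` for the first claim; in a graph without vertices the conditions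
  -- hold trivially.
  somewhere : ∀ N → n G ≡ N → Σ (EdgeSet G) λ h → Σ (Orientation G) λ o → GoodDecomp G m M h o
  somewhere (suc N) eq with h , o , good , _ ← decomposition m 1≤m G conn M M≤m (subst Fin (sym eq) zero) =
    h , o , good
  somewhere zero eq = (λ _ → true) , (λ _ → true) ,
    ((λ _ _ → false) , (λ _ _ ()) ,
     (λ i → (λ v → ⊥-elim (no-vertex v)) , λ cyc → no-vertex (Cycle.vs cyc zero)) , λ _ _ _ _ ()) ,
    (λ _ _ → refl) , λ v → ⊥-elim (no-vertex v)
    where
    no-vertex : ¬ Fin (n G)
    no-vertex v with () ← subst Fin eq v
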